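{- Let $d\ge 1$ and let $\mathbf{s}=(s_1,\ldots,s_d)$ be a sequence of positive integers such that $s_1=\cdots=s_i$ for some $1\le i\le d$, and $s_j<s_{j+1}$ for all $i\le j\le d-1$. Suppose that $\mathbf{P}_d^{(\mathbf{s})}$ is translation equivalent to a Fano polytope. Then $\mathbf{P}_d^{(\mathbf{s})}$ is reflexive up to translation if and only if for all $i\le j\le d-1$ one has $k_j\mid s_j$ and $k_j\mid s_{j+1}$, where $k_j=s_{j+1}-s_j$.
   Context: For a sequence of positive integers $\mathbf{s}=(s_1,\ldots,s_d)$, the $\mathbf{s}$-lecture hall polytope is $\mathbf{P}_d^{(\mathbf{s})}=\{\mathbf{x}\in\mathbb{R}^d : 0\le \frac{x_1}{s_1}\le\frac{x_2}{s_2}\le\cdots\le\frac{x_d}{s_d}\le 1\}$, a $d$-dimensional lattice polytope. A $d$-dimensional lattice polytope $\mathcal{P}\subset\mathbb{R}^d$ is Fano if $(\mathcal{P}\setminus\partial\mathcal{P})\cap\mathbb{Z}^d=\{\mathbf{0}\}$. It is reflexive if it is Fano and its dual polytope $\mathcal{P}^\vee=\{y\in\mathbb{R}^d : \langle x,y\rangle\le 1 \text{ for all } x\in\mathcal{P}\}$ is a lattice polytope. Two lattice polytopes are translation equivalent if one is the translate of the other by a vector in $\mathbb{Z}^d$; "reflexive up to translation" means translation equivalent to a reflexive polytope. -}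

module Defs where

open import Level using (Level; _⊔_) renaming (suc to lsuc)
open import Algebra.Apartness.Bundles using (HeytingField; HeytingCommutativeRing)
open import Algebra.Bundles using (CommutativeRing)
import Algebra.Definitions.RawMonoid as RawMonoidDefinitions
import Algebra.Properties.Ring as RingProperties
open import Data.Fin.Base using (Fin; zero; suc; inject₁; fromℕ)
open import Data.Integer.Base using (ℤ; +_; -[1+_])
open import Data.Nat.Base as ℕ using (ℕ; zero; suc; NonZero)
open import Data.Product.Base using (∃; ∃-syntax; _×_; _,_; proj₁)
open import Data.Sum.Base using (_⊎_; inj₁; inj₂)
open import Data.Vec.Functional using (Vector)
open import Function.Bundles using (_⇔_; module Equivalence)
open import Relation.Binary.Core using (Rel)
open import Relation.Binary.Structures using (IsStrictPartialOrder)
open import Relation.Nullary.Negation using (¬_)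
open import Relation.Unary using (Pred; _∩_; _≐_)

-- The real numbers, characterised axiomatically as a Cauchy complete
-- Archimedean ordered field. No decidability of the order is assumed, so
-- both the classical reals (in a classical metatheory) and the reals of
-- constructive analysis satisfy these axioms. Cotransitivity of _<_ and
-- tightness of _≤_ are inherited from the apartness of the Heyting field.

record RealNumbers (c ℓ₁ ℓ₂ : Level) : Set (lsuc (c ⊔ ℓ₁ ⊔ ℓ₂)) where
  field
    heytingField : HeytingField c ℓ₁ ℓ₂

  open HeytingField heytingField public renaming (zero to *-zero)

  commutativeRing : CommutativeRing c ℓ₁
  commutativeRing =
    HeytingCommutativeRing.commutativeRing heytingCommutativeRing

  open CommutativeRing commutativeRing public using (ring; +-rawMonoid)
  open RawMonoidDefinitions +-rawMonoid public using (sum)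
    renaming (_×_ to _·_)

  infix 4 _<_ _≤_

  field
    _<_                  : Rel Carrier ℓ₂
    isStrictPartialOrder : IsStrictPartialOrder _≈_ _<_
    #⇔<⊎>                : ∀ {x y} → (x # y) ⇔ (x < y ⊎ y < x)
    +-monoˡ-<            : ∀ {x y} z → x < y → x + z < y + z
    *-pos                : ∀ {x y} → 0# < x → 0# < y → 0# < x * y

  _≤_ : Rel Carrier ℓ₂
  x ≤ y = ¬ (y < x)

  -- ∣ x - y ∣ < ε
  Within : Carrier → Carrier → Carrier → Set ℓ₂
  Within ε x y = (- ε < x - y) × (x - y < ε)

  Cauchy : (ℕ → Carrier) → Set (c ⊔ ℓ₂)
  Cauchy f = ∀ ε → 0# < ε →
    ∃[ N ] (∀ m n → N ℕ.≤ m → N ℕ.≤ n → Within ε (f m) (f n))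

  ConvergesTo : (ℕ → Carrier) → Carrier → Set (c ⊔ ℓ₂)
  ConvergesTo f l = ∀ ε → 0# < ε →
    ∃[ N ] (∀ n → N ℕ.≤ n → Within ε (f n) l)

  field
    archimedean : ∀ x → ∃[ n ] (x < n · 1#)
    complete    : ∀ f → Cauchy f → ∃[ l ] ConvergesTo f l

  open IsStrictPartialOrder isStrictPartialOrder public
    using (<-resp-≈; <-respˡ-≈; <-respʳ-≈)
    renaming (irrefl to <-irrefl; trans to <-trans; asym to <-asym)

  fromℤ : ℤ → Carrier
  fromℤ (+ n)    = n · 1#
  fromℤ -[1+ n ] = - (suc n · 1#)

  0<1 : 0# < 1#
  0<1 with Equivalence.to #⇔<⊎> 1#0
    where
    1-0≈1 : 1# - 0# ≈ 1#
    1-0≈1 = trans (+-congˡ (RingProperties.-0#≈0# ring)) (+-identityʳ 1#)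

    1#0 : 1# # 0#
    1#0 = invertible⇒#
      (1# , trans (*-identityˡ _) 1-0≈1 , trans (*-identityʳ _) 1-0≈1)
  ... | inj₂ 0<1′ = 0<1′
  ... | inj₁ 1<0  = <-respʳ-≈ -1*-1≈1 (*-pos 0<-1 0<-1)
    where
    0<-1 : 0# < - 1#
    0<-1 = <-respˡ-≈ (-‿inverseʳ 1#)
             (<-respʳ-≈ (+-identityˡ (- 1#)) (+-monoˡ-< (- 1#) 1<0))

    -1*-1≈1 : - 1# * - 1# ≈ 1#
    -1*-1≈1 = trans (RingProperties.-1*x≈-x ring (- 1#))
                    (RingProperties.-‿involutive ring 1#)

  0<suc : ∀ n → 0# < suc n · 1#
  0<suc zero    = <-respʳ-≈ (sym (+-identityʳ 1#)) 0<1
  0<suc (suc n) = <-trans (0<suc n)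
    (<-respˡ-≈ (+-identityˡ _) (+-monoˡ-< (suc n · 1#) 0<1))

  -- #⇒invertible yields an inverse of n · 1# - 0#, i.e. of n.
  reciprocal : ∀ n → .{{NonZero n}} → Carrier
  reciprocal (suc n) =
    proj₁ (#⇒invertible (Equivalence.from #⇔<⊎> (inj₂ (0<suc n))))

  infixl 7 _/_
  _/_ : Carrier → ∀ n → .{{NonZero n}} → Carrier
  x / n = x * reciprocal n

module _ {c ℓ₁ ℓ₂ : Level} (ℝ : RealNumbers c ℓ₁ ℓ₂) where

  open RealNumbers ℝ

  infix 4 _≋_
  _≋_ : ∀ {d} → Rel (Vector Carrier d) ℓ₁
  x ≋ y = ∀ j → x j ≈ y j

  embed : ∀ {d} → Vector ℤ d → Vector Carrier d
  embed z j = fromℤ (z j)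

  ⟨_,_⟩ : ∀ {d} → Vector Carrier d → Vector Carrier d → Carrier
  ⟨ x , y ⟩ = sum (λ j → x j * y j)

  combination : ∀ {d m} → Vector Carrier m → Vector (Vector Carrier d) m →
                Vector Carrier d
  combination w v j = sum (λ k → w k * v k j)

  ConvexHull : ∀ {d m} → Vector (Vector Carrier d) m →
               Pred (Vector Carrier d) (c ⊔ ℓ₁ ⊔ ℓ₂)
  ConvexHull v x = ∃[ w ]
    (∀ k → 0# ≤ w k) × (sum w ≈ 1#) × (x ≋ combination w v)

  AffineHull : ∀ {d ℓ} → Pred (Vector Carrier d) ℓ →
               Pred (Vector Carrier d) (c ⊔ ℓ₁ ⊔ ℓ)
  AffineHull P x = ∃[ m ] ∃[ v ] ∃[ w ]
    (∀ (k : Fin m) → P (v k)) × (sum w ≈ 1#) × (x ≋ combination w v)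

  LatticePolytope : ∀ {d ℓ} → Pred (Vector Carrier d) ℓ →
                    Set (c ⊔ ℓ₁ ⊔ ℓ₂ ⊔ ℓ)
  LatticePolytope {d} P =
    ∃[ m ] ∃ λ (v : Vector (Vector ℤ d) m) → P ≐ ConvexHull (λ k → embed (v k))

  -- The dimension of P is that of its affine hull.
  FullDimensional : ∀ {d ℓ} → Pred (Vector Carrier d) ℓ → Set (c ⊔ ℓ₁ ⊔ ℓ)
  FullDimensional P = ∀ x → AffineHull P x

  -- P ∖ ∂P, i.e. the topological interior: open boxes form a base of the
  -- topology of ℝᵈ.
  Interior : ∀ {d ℓ} → Pred (Vector Carrier d) ℓ →
             Pred (Vector Carrier d) (c ⊔ ℓ₂ ⊔ ℓ)
  Interior P x = ∃[ ε ] (0# < ε) × (∀ y → (∀ j → Within ε (y j) (x j)) → P y)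

  Lattice : ∀ {d} → Pred (Vector Carrier d) ℓ₁
  Lattice x = ∃[ z ] (x ≋ embed z)

  Origin : ∀ {d} → Pred (Vector Carrier d) ℓ₁
  Origin x = x ≋ (λ _ → 0#)

  Fano : ∀ {d ℓ} → Pred (Vector Carrier d) ℓ → Set (c ⊔ ℓ₁ ⊔ ℓ₂ ⊔ ℓ)
  Fano P = LatticePolytope P × FullDimensional P ×
           ((Interior P ∩ Lattice) ≐ Origin)

  Dual : ∀ {d ℓ} → Pred (Vector Carrier d) ℓ →
         Pred (Vector Carrier d) (c ⊔ ℓ₂ ⊔ ℓ)
  Dual P y = ∀ x → P x → ⟨ x , y ⟩ ≤ 1#

  Reflexive : ∀ {d ℓ} → Pred (Vector Carrier d) ℓ → Set (c ⊔ ℓ₁ ⊔ ℓ₂ ⊔ ℓ)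
  Reflexive P = Fano P × LatticePolytope (Dual P)

  Translate : ∀ {d ℓ} → Vector ℤ d → Pred (Vector Carrier d) ℓ →
              Pred (Vector Carrier d) (c ⊔ ℓ₁ ⊔ ℓ)
  Translate t P x = ∃[ y ] P y × (x ≋ (λ j → y j + embed t j))

  TranslationEquivalent : ∀ {d ℓ ℓ′} → Pred (Vector Carrier d) ℓ →
                          Pred (Vector Carrier d) ℓ′ → Set (c ⊔ ℓ₁ ⊔ ℓ ⊔ ℓ′)
  TranslationEquivalent P Q = ∃[ t ] (Q ≐ Translate t P)

  -- The level at which Q is quantified is that of every translate of a
  -- lecture hall polytope, so it imposes no restriction on such P.
  FanoUpToTranslation : ∀ {d ℓ} → Pred (Vector Carrier d) ℓ →
                        Set (lsuc (c ⊔ ℓ₁ ⊔ ℓ₂) ⊔ ℓ)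
  FanoUpToTranslation {d} P =
    ∃ λ (Q : Pred (Vector Carrier d) (c ⊔ ℓ₁ ⊔ ℓ₂)) →
      Fano Q × TranslationEquivalent P Q

  ReflexiveUpToTranslation : ∀ {d ℓ} → Pred (Vector Carrier d) ℓ →
                             Set (lsuc (c ⊔ ℓ₁ ⊔ ℓ₂) ⊔ ℓ)
  ReflexiveUpToTranslation {d} P =
    ∃ λ (Q : Pred (Vector Carrier d) (c ⊔ ℓ₁ ⊔ ℓ₂)) →
      Reflexive Q × TranslationEquivalent P Q

  -- Here d = suc n; the consecutive pairs of coordinates are
  -- (inject₁ j , suc j) for j : Fin n.
  LectureHall : ∀ {n} (s : Vector ℕ (suc n)) → (∀ j → NonZero (s j)) →
                Pred (Vector Carrier (suc n)) ℓ₂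
  LectureHall {n} s s≢0 x =
    (0# ≤ ratio zero) ×
    (∀ (j : Fin n) → ratio (inject₁ j) ≤ ratio (suc j)) ×
    (ratio (fromℕ n) ≤ 1#)
    where
    ratio : Fin (suc n) → Carrier
    ratio j = _/_ (x j) (s j) {{s≢0 j}}

module Submission where

-- Translate the lecture hall simplex so that its interior lattice point q becomes the origin. Its facets are then
-- κₖ + Lₖ(x) ≥ 0, where κₖ > 0 is the value at q of sₖ xₖ₊₁ − sₖ₊₁ xₖ. The vertices of the dual are the normals
-- −Lₖ/κₖ, whose only nonzero coordinates are sₖ₊₁/κₖ and −sₖ/κₖ, so the dual is a lattice polytope exactly when every
-- κₖ divides sₖ and sₖ₊₁. Uniqueness of the interior lattice point means that no q ± eⱼ is interior; this forces
-- κₖ = s₁ on the constant part of s and, descending from q_d = s_d − 1, qⱼ = sⱼ − 1 on the increasing part, where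
-- therefore κⱼ = sⱼ₊₁ − sⱼ.

-- The order of the reals is not decidable and `≤` is the negation of `<`, so no argument may split
-- on the sign of an arbitrary real. Case distinctions are made over ℤ and on indices; over the
-- reals, strict inequalities come from cotransitivity and equalities from tightness. So the
-- vertices of the dual are not found by discarding zero weights: whenever a normal is a convex
-- combination of points of the dual, one positively weighted point suffices, since it must equal
-- that normal.
--
-- Duality rests on one formula. With s padded by 1 at both ends, let vₖ be the vertex opposite
-- facet k, aₖ = -Lₖ/κₖ, and τₖ = 1 - ⟨vₖ, y⟩ the slack of y at vₖ. Then y = Σ wₖ aₖ with wₖ = κₖ τₖ
-- / (sₖ sₖ₊₁) and Σ wₖ = 1. This exhibits the dual as the hull of the normals, and it shows that a
-- point whose slacks vanish at all vertices but one is a normal.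

open import Defs
open import Algebra.Bundles using (CommutativeRing)
import Algebra.Apartness.Properties.HeytingCommutativeRing as HeytingProperties
import Algebra.Properties.Ring as RingProperties
import Algebra.Properties.Semiring.Mult as SemiringMult
import Algebra.Properties.Semiring.Sum as SemiringSum
import Algebra.Solver.Ring as RingSolver
open import Algebra.Solver.Ring.AlmostCommutativeRing using (fromCommutativeRing; _-Raw-AlmostCommutative⟶_)
open import Data.Fin.Base as Fin using (Fin; zero; suc; inject₁; fromℕ)
open import Data.Fin.Induction using (>-weakInduction)
import Data.Fin.Properties as Fin
open import Data.Fin.Relation.Unary.Top using (view; ‵fromℕ; ‵inject₁)
open import Data.Integer.Base as ℤ using (ℤ; +_; -[1+_])
import Data.Integer.Properties as ℤ
open import Data.Integer.Tactic.RingSolver using (solve-∀)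
open import Data.Maybe.Base using (Maybe; just; nothing)
open import Data.Nat.Base as ℕ using (ℕ; zero; suc; _∸_; NonZero)
open import Data.Nat.Divisibility using (_∣_; divides; ∣-refl; ∣m+n∣m⇒∣n)
import Data.Nat.Properties as ℕ
open import Data.Product.Base using (∃; _×_; _,_; proj₁; proj₂)
open import Data.Sum.Base using (_⊎_; inj₁; inj₂)
open import Data.Vec.Functional as Vector using (Vector)
open import Function.Base using (_∘_)
open import Function.Bundles using (_⇔_; mk⇔; module Equivalence)
open import Relation.Binary.Definitions using (tri<; tri≈; tri>)
open import Relation.Binary.PropositionalEquality as ≡ using (_≡_; _≢_)
import Relation.Binary.Reasoning.Setoid as SetoidReasoning
open import Relation.Nullary.Decidable using (yes; no)
open import Relation.Nullary.Negation using (¬_; contradiction)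
open import Relation.Unary using (Pred; _⊆_; _∩_; _≐_)

-- Ordered field

module OrderedField {c ℓ₁ ℓ₂} (ℝ : RealNumbers c ℓ₁ ℓ₂) where

  open RealNumbers ℝ
  private module R = CommutativeRing commutativeRing
  open RingProperties ring using (-‿+-comm; -‿distribˡ-*; -‿distribʳ-*; -0#≈0#; -‿involutive)
  open SemiringMult R.semiring using (×-homo-+; ×1-homo-*)
  open HeytingProperties heytingCommutativeRing using (invertibleˡ⇒#)
  open SetoidReasoning R.setoid

  fromℤ-neg : ∀ a → fromℤ (ℤ.- a) ≈ - fromℤ a
  fromℤ-neg (+ 0)       = sym -0#≈0#
  fromℤ-neg (+ (suc n)) = refl
  fromℤ-neg -[1+ n ]    = sym (-‿involutive _)

  fromℤ-⊖ : ∀ m n → fromℤ (m ℤ.⊖ n) ≈ m · 1# - n · 1#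
  fromℤ-⊖ m zero = begin
    m · 1#       ≈⟨ +-identityʳ _ ⟨
    m · 1# + 0#  ≈⟨ +-congˡ -0#≈0# ⟨
    m · 1# - 0#  ∎
  fromℤ-⊖ zero (suc n) = sym (+-identityˡ _)
  fromℤ-⊖ (suc m) (suc n) = begin
    fromℤ (suc m ℤ.⊖ suc n)               ≡⟨ ≡.cong fromℤ (ℤ.[1+m]⊖[1+n]≡m⊖n m n) ⟩
    fromℤ (m ℤ.⊖ n)                       ≈⟨ fromℤ-⊖ m n ⟩
    m · 1# - n · 1#                       ≈⟨ +-identityˡ _ ⟨
    0# + (m · 1# - n · 1#)                ≈⟨ +-congʳ (-‿inverseʳ 1#) ⟨
    (1# - 1#) + (m · 1# - n · 1#)         ≈⟨ +-assoc _ _ _ ⟩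
    1# + (- 1# + (m · 1# - n · 1#))       ≈⟨ +-congˡ (+-assoc _ _ _) ⟨
    1# + ((- 1# + m · 1#) - n · 1#)       ≈⟨ +-congˡ (+-congʳ (+-comm _ _)) ⟩
    1# + ((m · 1# - 1#) - n · 1#)         ≈⟨ +-congˡ (+-assoc _ _ _) ⟩
    1# + (m · 1# + (- 1# - n · 1#))       ≈⟨ +-assoc _ _ _ ⟨
    suc m · 1# + (- 1# - n · 1#)          ≈⟨ +-congˡ (-‿+-comm _ _) ⟩
    suc m · 1# - suc n · 1#               ∎

  fromℤ-+ : ∀ a b → fromℤ (a ℤ.+ b) ≈ fromℤ a + fromℤ b
  fromℤ-+ (+ m)    (+ n)    = ×-homo-+ 1# m n
  fromℤ-+ (+ m)    -[1+ n ] = fromℤ-⊖ m (suc n)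
  fromℤ-+ -[1+ m ] (+ n)    = trans (fromℤ-⊖ n (suc m)) (+-comm _ _)
  fromℤ-+ -[1+ m ] -[1+ n ] = begin
    - (suc (suc (m ℕ.+ n)) · 1#)      ≡⟨ ≡.cong (λ k → - (k · 1#)) (ℕ.+-suc (suc m) n) ⟨
    - ((suc m ℕ.+ suc n) · 1#)        ≈⟨ -‿cong (×-homo-+ 1# (suc m) (suc n)) ⟩
    - (suc m · 1# + suc n · 1#)       ≈⟨ -‿+-comm _ _ ⟨
    - (suc m · 1#) - suc n · 1#       ∎

  private
    fromℤ-+*+ : ∀ m n → fromℤ (+ m ℤ.* + n) ≈ m · 1# * (n · 1#)
    fromℤ-+*+ m n = begin
      fromℤ (+ m ℤ.* + n)  ≡⟨ ≡.cong fromℤ (ℤ.pos-* m n) ⟨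
      (m ℕ.* n) · 1#       ≈⟨ ×1-homo-* m n ⟩
      m · 1# * (n · 1#)    ∎

  fromℤ-* : ∀ a b → fromℤ (a ℤ.* b) ≈ fromℤ a * fromℤ b
  fromℤ-* (+ m) (+ n) = fromℤ-+*+ m n
  fromℤ-* (+ m) -[1+ n ] = begin
    fromℤ (+ m ℤ.* -[1+ n ])            ≡⟨ ≡.cong fromℤ (ℤ.neg-distribʳ-* (+ m) (+ suc n)) ⟨
    fromℤ (ℤ.- (+ m ℤ.* + suc n))       ≈⟨ fromℤ-neg (+ m ℤ.* + suc n) ⟩
    - fromℤ (+ m ℤ.* + suc n)           ≈⟨ -‿cong (fromℤ-+*+ m (suc n)) ⟩
    - (m · 1# * (suc n · 1#))           ≈⟨ -‿distribʳ-* _ _ ⟩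
    m · 1# * (- (suc n · 1#))           ∎
  fromℤ-* -[1+ m ] (+ n) = begin
    fromℤ (-[1+ m ] ℤ.* + n)            ≡⟨ ≡.cong fromℤ (ℤ.neg-distribˡ-* (+ suc m) (+ n)) ⟨
    fromℤ (ℤ.- (+ suc m ℤ.* + n))       ≈⟨ fromℤ-neg (+ suc m ℤ.* + n) ⟩
    - fromℤ (+ suc m ℤ.* + n)           ≈⟨ -‿cong (fromℤ-+*+ (suc m) n) ⟩
    - (suc m · 1# * (n · 1#))           ≈⟨ -‿distribˡ-* _ _ ⟩
    - (suc m · 1#) * (n · 1#)           ∎
  fromℤ-* -[1+ m ] -[1+ n ] = begin
    (suc m ℕ.* suc n) · 1#                  ≈⟨ ×1-homo-* (suc m) (suc n) ⟩
    suc m · 1# * (suc n · 1#)               ≈⟨ -‿involutive _ ⟨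
    - (- (suc m · 1# * (suc n · 1#)))       ≈⟨ -‿cong (-‿distribˡ-* _ _) ⟩
    - (- (suc m · 1#) * (suc n · 1#))       ≈⟨ -‿distribʳ-* _ _ ⟩
    - (suc m · 1#) * (- (suc n · 1#))       ∎

  -- `fromℤ (+ 1)` unfolds to `1# + 0#`, so the solver's `con (+ 1)` is not literally `1#`; later
  -- calls pass `1#` as a variable.
  fromℤ-1 : fromℤ (+ 1) ≈ 1#
  fromℤ-1 = +-identityʳ 1#

  private
    morphism : CommutativeRing.rawRing ℤ.+-*-commutativeRing
               -Raw-AlmostCommutative⟶ fromCommutativeRing commutativeRing
    morphism = record
      { ⟦_⟧    = fromℤ
      ; +-homo = fromℤ-+
      ; *-homo = fromℤ-*
      ; -‿homo = fromℤ-neg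
      ; 0-homo = refl
      ; 1-homo = fromℤ-1
      }

    coeff≟ : ∀ a b → Maybe (fromℤ a ≈ fromℤ b)
    coeff≟ a b with a ℤ.≟ b
    ... | yes ≡.refl = just refl
    ... | no  _      = nothing

  open RingSolver _ _ morphism coeff≟ public
    using (solve; _:=_; _:+_; _:*_; _:-_; :-_; con)

  fromℤ-minus : ∀ a b → fromℤ (a ℤ.- b) ≈ fromℤ a - fromℤ b
  fromℤ-minus a b = trans (fromℤ-+ a (ℤ.- b)) (+-congˡ (fromℤ-neg b))

  private
    x-y+y≈x : ∀ x y → (x - y) + y ≈ x
    x-y+y≈x = solve 2 (λ x y → (x :- y) :+ y := x) refl

  x<y⇒0<y-x : ∀ {x y} → x < y → 0# < y - x
  x<y⇒0<y-x {x} x<y = <-respˡ-≈ (-‿inverseʳ x) (+-monoˡ-< (- x) x<y)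

  0<y-x⇒x<y : ∀ {x y} → 0# < y - x → x < y
  0<y-x⇒x<y {x} {y} 0<y-x = <-respˡ-≈ (+-identityˡ x) (<-respʳ-≈ (x-y+y≈x y x) (+-monoˡ-< x 0<y-x))

  -- Stands in for trichotomy. Apartness has no direction, but when it resolves against the wanted
  -- side, transitivity with `x < y` yields the other alternative.
  <-cotrans : ∀ {x y} → x < y → ∀ z → x < z ⊎ z < y
  <-cotrans {x} {y} x<y z with #-cotrans (Equivalence.from #⇔<⊎> (inj₁ x<y)) z
  ... | inj₁ x#z with Equivalence.to #⇔<⊎> x#z
  ...   | inj₁ x<z = inj₁ x<z
  ...   | inj₂ z<x = inj₂ (<-trans z<x x<y)
  <-cotrans {x} {y} x<y z | inj₂ z#y with Equivalence.to #⇔<⊎> z#y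
  ...   | inj₁ z<y = inj₂ z<y
  ...   | inj₂ y<z = inj₁ (<-trans x<y y<z)

  <⇒≤ : ∀ {x y} → x < y → x ≤ y
  <⇒≤ = <-asym

  ≈⇒≤ : ∀ {x y} → x ≈ y → x ≤ y
  ≈⇒≤ x≈y y<x = <-irrefl (sym x≈y) y<x

  ≤-trans : ∀ {x y z} → x ≤ y → y ≤ z → x ≤ z
  ≤-trans {y = y} x≤y y≤z z<x with <-cotrans z<x y
  ... | inj₁ z<y = y≤z z<y
  ... | inj₂ y<x = x≤y y<x

  ≤-antisym : ∀ {x y} → x ≤ y → y ≤ x → x ≈ y
  ≤-antisym {x} {y} x≤y y≤x = proj₁ (tight x y) x¬#y
    where
    x¬#y : ¬ (x # y)
    x¬#y x#y with Equivalence.to #⇔<⊎> x#y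
    ... | inj₁ x<y = y≤x x<y
    ... | inj₂ y<x = x≤y y<x

  ≤-respʳ-≈ : ∀ {x y z} → y ≈ z → x ≤ y → x ≤ z
  ≤-respʳ-≈ y≈z x≤y z<x = x≤y (<-respˡ-≈ (sym y≈z) z<x)

  0≤y-x⇒x≤y : ∀ {x y} → 0# ≤ y - x → x ≤ y
  0≤y-x⇒x≤y {x} {y} 0≤y-x y<x = 0≤y-x
    (<-respˡ-≈ (+-congˡ refl) (<-respʳ-≈ (-‿inverseʳ x) (+-monoˡ-< (- x) y<x)))

  x≤y⇒0≤y-x : ∀ {x y} → x ≤ y → 0# ≤ y - x
  x≤y⇒0≤y-x {x} {y} x≤y y-x<0 = x≤y
    (<-respʳ-≈ (+-identityˡ x) (<-respˡ-≈ (x-y+y≈x y x) (+-monoˡ-< x y-x<0)))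

  +-mono-0<-0≤ : ∀ {x y} → 0# < x → 0# ≤ y → 0# < x + y
  +-mono-0<-0≤ {x} {y} 0<x 0≤y with <-cotrans (<-respˡ-≈ (+-identityˡ y) (+-monoˡ-< y 0<x)) 0#
  ... | inj₁ y<0 = contradiction y<0 0≤y
  ... | inj₂ 0<  = 0<

  x≤x+y : ∀ {x y} → 0# ≤ y → x ≤ x + y
  x≤x+y {x} {y} 0≤y = 0≤y-x⇒x≤y (≤-respʳ-≈ (solve 2 (λ x y → y := x :+ y :- x) refl x y) 0≤y)

  +-mono-0≤ : ∀ {x y} → 0# ≤ x → 0# ≤ y → 0# ≤ x + y
  +-mono-0≤ 0≤x 0≤y = ≤-trans 0≤x (x≤x+y 0≤y)

  -- Cotransitivity of `0# < x + y` at `x`. This is what lets `sum-pos` return an actual index.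
  x+y>0⇒x>0⊎y>0 : ∀ {x y} → 0# < x + y → 0# < x ⊎ 0# < y
  x+y>0⇒x>0⊎y>0 {x} {y} 0<x+y with <-cotrans 0<x+y x
  ... | inj₁ 0<x   = inj₁ 0<x
  ... | inj₂ x<x+y = inj₂ (<-respʳ-≈ (solve 2 (λ x y → x :+ y :- x := y) refl x y) (x<y⇒0<y-x x<x+y))

  sum-pos : ∀ {m} (v : Vector Carrier m) → 0# < sum v → ∃ λ k → 0# < v k
  sum-pos {zero}  v 0<0 = contradiction 0<0 (<-irrefl refl)
  sum-pos {suc m} v 0<∑ with x+y>0⇒x>0⊎y>0 0<∑
  ... | inj₁ 0<v₀ = zero , 0<v₀
  ... | inj₂ 0<∑′ with sum-pos (v ∘ suc) 0<∑′
  ...   | k , 0<vₖ = suc k , 0<vₖ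

  sum-nonneg : ∀ {m} (v : Vector Carrier m) → (∀ k → 0# ≤ v k) → 0# ≤ sum v
  sum-nonneg {zero}  v 0≤v = ≈⇒≤ refl
  sum-nonneg {suc m} v 0≤v = +-mono-0≤ (0≤v zero) (sum-nonneg (v ∘ suc) (0≤v ∘ suc))

  x*[1-y]≈x-x*y : ∀ x y → x * (1# - y) ≈ x - x * y
  x*[1-y]≈x-x*y x y = trans (solve 3 (λ x u y → x :* (u :- y) := x :* u :- x :* y) refl x 1# y)
                            (+-congʳ (*-identityʳ x))

  x<0⇒0<-x : ∀ {x} → x < 0# → 0# < - x
  x<0⇒0<-x {x} x<0 = <-respʳ-≈ (+-identityˡ (- x)) (x<y⇒0<y-x x<0)

  *-inverse⇒#0 : ∀ {x y} → x * y ≈ 1# → y # 0#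
  *-inverse⇒#0 {x} {y} x*y≈1 = invertibleˡ⇒#
    (x , trans (solve 2 (λ x y → x :* (y :- con (+ 0)) := x :* y) refl x y) x*y≈1)

  -- The signs of the factors cannot be decided. But a negative product is invertible, hence so is
  -- each factor; nonnegative numbers apart from zero are positive, and then so is their product.
  *-mono-0≤ : ∀ {x y} → 0# ≤ x → 0# ≤ y → 0# ≤ x * y
  *-mono-0≤ {x} {y} 0≤x 0≤y x*y<0 = <-asym x*y<0 (*-pos (positive 0≤x x#0) (positive 0≤y y#0))
    where
    positive : ∀ {z} → 0# ≤ z → z # 0# → 0# < z
    positive 0≤z z#0 with Equivalence.to #⇔<⊎> z#0
    ... | inj₁ z<0 = contradiction z<0 0≤z
    ... | inj₂ 0<z = 0<z

    inverse : ∃ λ z → z * (x * y) ≈ 1#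
    inverse with #⇒invertible (Equivalence.from #⇔<⊎> (inj₁ x*y<0))
    ... | z , z*[x*y-0]≈1 , _ = z ,
      trans (solve 3 (λ x y z → z :* (x :* y) := z :* (x :* y :- con (+ 0))) refl x y z) z*[x*y-0]≈1

    x#0 : x # 0#
    x#0 = *-inverse⇒#0 (trans (solve 3 (λ x y z → z :* y :* x := z :* (x :* y)) refl x y (proj₁ inverse))
                              (proj₂ inverse))

    y#0 : y # 0#
    y#0 = *-inverse⇒#0 (trans (solve 3 (λ x y z → z :* x :* y := z :* (x :* y)) refl x y (proj₁ inverse))
                              (proj₂ inverse))

  *-cancelˡ-0≤ : ∀ {x y} → 0# < x → 0# ≤ x * y → 0# ≤ y
  *-cancelˡ-0≤ {x} {y} 0<x 0≤x*y y<0 = <-irrefl refl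
    (<-respʳ-≈ (solve 2 (λ x y → x :* (:- y) :+ x :* y := con (+ 0)) refl x y)
      (+-mono-0<-0≤ (*-pos 0<x (x<0⇒0<-x y<0)) 0≤x*y))

  inverse-pos : ∀ {x y} → 0# < x → x * y ≈ 1# → 0# < y
  inverse-pos {x} {y} 0<x x*y≈1 with Equivalence.to #⇔<⊎> (*-inverse⇒#0 x*y≈1)
  ... | inj₂ 0<y = 0<y
  ... | inj₁ y<0 = contradiction y<0
    (*-cancelˡ-0≤ 0<x (<⇒≤ (<-respʳ-≈ (sym x*y≈1) 0<1)))

  pos-inverse : ∀ {x} → 0# < x → ∃ λ y → x * y ≈ 1#
  pos-inverse {x} 0<x with #⇒invertible (Equivalence.from #⇔<⊎> (inj₂ 0<x))
  ... | y , _ , [x-0]*y≈1 =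
    y , trans (solve 2 (λ x y → x :* y := (x :- con (+ 0)) :* y) refl x y) [x-0]*y≈1

  reciprocal-inverse : ∀ n .{{_ : NonZero n}} → fromℤ (+ n) * reciprocal n ≈ 1#
  reciprocal-inverse (suc n) = proj₂ (pos-inverse (0<suc n))

  0<fromℤ : ∀ {a} → + 0 ℤ.< a → 0# < fromℤ a
  0<fromℤ {+ suc n} _ = 0<suc n
  0<fromℤ {+ zero} (ℤ.+<+ ())

  0≤fromℤ : ∀ {a} → + 0 ℤ.≤ a → 0# ≤ fromℤ a
  0≤fromℤ {+ zero}  _ = ≈⇒≤ refl
  0≤fromℤ {+ suc n} _ = <⇒≤ (0<suc n)

  fromℤ-injective : ∀ {a b} → fromℤ a ≈ fromℤ b → a ≡ b
  fromℤ-injective {a} {b} a≈b with ℤ.<-cmp (+ 0) (a ℤ.- b)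
  ... | tri≈ _ 0≡a-b _ = ℤ.i-j≡0⇒i≡j a b (≡.sym 0≡a-b)
  ... | tri< 0<a-b _ _ = contradiction (0<fromℤ 0<a-b) (≈⇒≤ (begin
    fromℤ (a ℤ.- b)      ≈⟨ fromℤ-minus a b ⟩
    fromℤ a - fromℤ b    ≈⟨ +-congʳ a≈b ⟩
    fromℤ b - fromℤ b    ≈⟨ -‿inverseʳ _ ⟩
    0#                   ∎))
  ... | tri> _ _ a-b<0 = contradiction (0<fromℤ (ℤ.neg-mono-< a-b<0)) (≈⇒≤ (begin
    fromℤ (ℤ.- (a ℤ.- b))    ≈⟨ fromℤ-neg (a ℤ.- b) ⟩
    - fromℤ (a ℤ.- b)        ≈⟨ -‿cong (fromℤ-minus a b) ⟩
    - (fromℤ a - fromℤ b)    ≈⟨ -‿cong (+-congʳ a≈b) ⟩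
    - (fromℤ b - fromℤ b)    ≈⟨ -‿cong (-‿inverseʳ _) ⟩
    - 0#                     ≈⟨ -0#≈0# ⟩
    0#                       ∎))

  0<fromℤ⁻¹ : ∀ {a} → 0# < fromℤ a → + 0 ℤ.< a
  0<fromℤ⁻¹ {+ zero}   0<0 = contradiction 0<0 (<-irrefl refl)
  0<fromℤ⁻¹ {+ suc n}  _   = ℤ.+<+ (ℕ.s≤s ℕ.z≤n)
  0<fromℤ⁻¹ { -[1+ n ]} 0<a = contradiction
    (<-respʳ-≈ (-‿inverseʳ (suc n · 1#)) (+-mono-0<-0≤ (0<suc n) (<⇒≤ 0<a))) (<-irrefl refl)

-- Padded sequences

snoc : ∀ {a} {A : Set a} {m} → Vector A m → A → Vector A (suc m)
snoc {m = zero}  v b _       = b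
snoc {m = suc m} v b zero    = v zero
snoc {m = suc m} v b (suc k) = snoc (v ∘ suc) b k

-- With x padded by 0 and 1 (ratios 0/1 and 1/1) and s by 1 and 1, the two end inequalities of a lecture hall polytope
-- get the shape sₖ xₖ₊₁ ≥ sₖ₊₁ xₖ of the inner ones. Coordinate j then sits at suc (inject₁ j) = inject₁ (suc j), and
-- the facets inject₁ j and suc j are those that involve it.
pad : ∀ {a} {A : Set a} {m} → A → Vector A m → A → Vector A (2 ℕ.+ m)
pad a v b = a Vector.∷ snoc v b

snoc-inject₁ : ∀ {a} {A : Set a} {m} (v : Vector A m) b j → snoc v b (inject₁ j) ≡ v j
snoc-inject₁ v b zero    = ≡.refl
snoc-inject₁ v b (suc j) = snoc-inject₁ (v ∘ suc) b j

snoc-fromℕ : ∀ {a} {A : Set a} {m} (v : Vector A m) b → snoc v b (fromℕ m) ≡ b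
snoc-fromℕ {m = zero}  v b = ≡.refl
snoc-fromℕ {m = suc m} v b = snoc-fromℕ (v ∘ suc) b

paddedCases : ∀ {m p} (P : Fin (2 ℕ.+ m) → Set p) →
              P zero → (∀ j → P (suc (inject₁ j))) → P (suc (fromℕ m)) → ∀ i → P i
paddedCases P P₀ Pⱼ Pₘ zero = P₀
paddedCases P P₀ Pⱼ Pₘ (suc k) with view k
... | ‵fromℕ     = Pₘ
... | ‵inject₁ j = Pⱼ j

-- `pad` does not reduce at an arbitrary inner position or at the last one; the rewriting that this
-- calls for is carried out here for any pointwise relation.
pad-lift₃ : ∀ {a b c r} {A : Set a} {B : Set b} {C : Set c} (R : A → B → C → Set r)
           {m} {u : Vector A m} {v : Vector B m} {w : Vector C m} {x₀ y₀ z₀ x₁ y₁ z₁} →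
           R x₀ y₀ z₀ → (∀ j → R (u j) (v j) (w j)) → R x₁ y₁ z₁ →
           ∀ i → R (pad x₀ u x₁ i) (pad y₀ v y₁ i) (pad z₀ w z₁ i)
pad-lift₃ R {u = u} {v} {w} {x₁ = x₁} {y₁} {z₁} R₀ Rⱼ R₁ = paddedCases _ R₀ inner last
  where
  inner : ∀ j → R (snoc u x₁ (inject₁ j)) (snoc v y₁ (inject₁ j)) (snoc w z₁ (inject₁ j))
  inner j rewrite snoc-inject₁ u x₁ j | snoc-inject₁ v y₁ j | snoc-inject₁ w z₁ j = Rⱼ j

  last : R (snoc u x₁ (fromℕ _)) (snoc v y₁ (fromℕ _)) (snoc w z₁ (fromℕ _))
  last rewrite snoc-fromℕ u x₁ | snoc-fromℕ v y₁ | snoc-fromℕ w z₁ = R₁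

pad-lift : ∀ {a b r} {A : Set a} {B : Set b} (R : A → B → Set r)
           {m} {u : Vector A m} {v : Vector B m} {x₀ y₀ x₁ y₁} →
           R x₀ y₀ → (∀ j → R (u j) (v j)) → R x₁ y₁ → ∀ i → R (pad x₀ u x₁ i) (pad y₀ v y₁ i)
pad-lift R {v = v} {y₀ = y₀} {y₁ = y₁} = pad-lift₃ (λ x y _ → R x y) {w = v} {z₀ = y₀} {z₁ = y₁}

-- Kronecker delta

δ : ∀ {m} → Fin m → Fin m → ℤ
δ zero    zero    = + 1
δ zero    (suc j) = + 0
δ (suc i) zero    = + 0
δ (suc i) (suc j) = δ i j

δ-sym : ∀ {m} (i j : Fin m) → δ i j ≡ δ j i
δ-sym zero    zero    = ≡.refl
δ-sym zero    (suc j) = ≡.refl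
δ-sym (suc i) zero    = ≡.refl
δ-sym (suc i) (suc j) = δ-sym i j

δ-refl : ∀ {m} (i : Fin m) → δ i i ≡ + 1
δ-refl zero    = ≡.refl
δ-refl (suc i) = δ-refl i

δ-≢ : ∀ {m} {i j : Fin m} → i ≢ j → δ i j ≡ + 0
δ-≢ {i = zero}  {zero}  i≢j = contradiction ≡.refl i≢j
δ-≢ {i = zero}  {suc j} i≢j = ≡.refl
δ-≢ {i = suc i} {zero}  i≢j = ≡.refl
δ-≢ {i = suc i} {suc j} i≢j = δ-≢ (i≢j ∘ ≡.cong suc)

δ-suc-inject₁ : ∀ {m} (i : Fin m) → δ (suc i) (inject₁ i) ≡ + 0
δ-suc-inject₁ zero    = ≡.refl
δ-suc-inject₁ (suc i) = δ-suc-inject₁ i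

δ-inject₁ : ∀ {l} (i j : Fin l) → δ (inject₁ i) (inject₁ j) ≡ δ i j
δ-inject₁ zero    zero    = ≡.refl
δ-inject₁ zero    (suc j) = ≡.refl
δ-inject₁ (suc i) zero    = ≡.refl
δ-inject₁ (suc i) (suc j) = δ-inject₁ i j

δ-inject₁-fromℕ : ∀ {l} (i : Fin l) → δ (inject₁ i) (fromℕ l) ≡ + 0
δ-inject₁-fromℕ zero    = ≡.refl
δ-inject₁-fromℕ (suc i) = δ-inject₁-fromℕ i

δ≤1 : ∀ {l} (i j : Fin l) → δ i j ℤ.≤ + 1
δ≤1 zero    zero    = ℤ.≤-refl
δ≤1 zero    (suc j) = ℤ.+≤+ ℕ.z≤n
δ≤1 (suc i) zero    = ℤ.+≤+ ℕ.z≤n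
δ≤1 (suc i) (suc j) = δ≤1 i j

0≤δ : ∀ {l} (i j : Fin l) → + 0 ℤ.≤ δ i j
0≤δ zero    zero    = ℤ.+≤+ ℕ.z≤n
0≤δ zero    (suc j) = ℤ.≤-refl
0≤δ (suc i) zero    = ℤ.≤-refl
0≤δ (suc i) (suc j) = 0≤δ i j

-- σₖ σₖ₊₁ times the increment of the ratios x/σ between neighbouring positions, that is, a facet
-- inequality with its denominators cleared.
slope : ∀ {m} → Vector ℤ (suc m) → Vector ℤ (suc m) → Vector ℤ m
slope σ x k = σ (inject₁ k) ℤ.* x (suc k) ℤ.- σ (suc k) ℤ.* x (inject₁ k)

-- cut k σ is the padded vertex opposite facet k.
cut : ∀ {m} → Fin m → Vector ℤ (suc m) → Vector ℤ (suc m)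
cut _       σ zero    = + 0
cut zero    σ (suc i) = σ (suc i)
cut (suc k) σ (suc i) = cut k (σ ∘ suc) i

-- The ratios of `cut k σ` to `σ` are 0 up to position k and 1 after it, so the only increment is
-- the one across facet k.
slope-cut : ∀ {m} k (σ : Vector ℤ (suc m)) f →
            slope σ (cut k σ) f ≡ δ k f ℤ.* (σ (inject₁ f) ℤ.* σ (suc f))
slope-cut zero σ zero = lemma (σ zero) (σ (suc zero))
  where
  lemma : ∀ x y → x ℤ.* y ℤ.- y ℤ.* + 0 ≡ + 1 ℤ.* (x ℤ.* y)
  lemma = solve-∀
slope-cut zero σ (suc f) = lemma (σ (suc (inject₁ f))) (σ (suc (suc f)))
  where
  lemma : ∀ x y → x ℤ.* y ℤ.- y ℤ.* x ≡ + 0 ℤ.* (x ℤ.* y)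
  lemma = solve-∀
slope-cut (suc k) σ zero = lemma (σ zero) (σ (suc zero))
  where
  lemma : ∀ x y → x ℤ.* + 0 ℤ.- y ℤ.* + 0 ≡ + 0 ℤ.* (x ℤ.* y)
  lemma = solve-∀
slope-cut (suc k) σ (suc f) = slope-cut k (σ ∘ suc) f

-- Moving the jump by one place changes only the entry that it passes, so vertices opposite
-- neighbouring facets differ by a multiple of a unit vector.
cut-inject₁ : ∀ {m} (j : Fin m) (σ : Vector ℤ (2 ℕ.+ m)) i →
              cut (inject₁ j) σ i ≡ cut (suc j) σ i ℤ.+ δ (suc (inject₁ j)) i ℤ.* σ i
cut-inject₁ j       σ zero          = ≡.refl
cut-inject₁ zero    σ (suc zero)    = ≡.sym (≡.trans (ℤ.+-identityˡ _) (ℤ.*-identityˡ _))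
cut-inject₁ zero    σ (suc (suc i)) = ≡.sym (ℤ.+-identityʳ _)
cut-inject₁ (suc j) σ (suc i)       = cut-inject₁ j (σ ∘ suc) i

cut-fromℕ : ∀ {m} k (σ : Vector ℤ (suc m)) → cut k σ (fromℕ m) ≡ σ (fromℕ m)
cut-fromℕ zero    σ = ≡.refl
cut-fromℕ (suc k) σ = cut-fromℕ k (σ ∘ suc)

-- Finite sums and pairings

module Sums {c ℓ₁ ℓ₂} (ℝ : RealNumbers c ℓ₁ ℓ₂) where

  open RealNumbers ℝ
  open OrderedField ℝ
  private module R = CommutativeRing commutativeRing
  open SemiringSum R.semiring
    using (sum-cong-≋; ∑-distrib-+; ∑-comm; *-distribˡ-sum; *-distribʳ-sum) public
  open SetoidReasoning R.setoid

  sum-*0 : ∀ {m} (v : Vector Carrier m) → sum (λ k → v k * 0#) ≈ 0#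
  sum-*0 v = trans (sym (*-distribʳ-sum 0# v)) (R.zeroʳ _)

  sum-minus : ∀ {m} (u v : Vector Carrier m) → sum (λ k → u k - v k) ≈ sum u - sum v
  sum-minus u v = begin
    sum (λ k → u k - v k)                  ≈⟨ sum-cong-≋ (λ k → minus (u k) (v k)) ⟩
    sum (λ k → u k + fromℤ ℤ.-1ℤ * v k)    ≈⟨ ∑-distrib-+ u _ ⟩
    sum u + sum (λ k → fromℤ ℤ.-1ℤ * v k)  ≈⟨ +-congˡ (*-distribˡ-sum _ v) ⟨
    sum u + fromℤ ℤ.-1ℤ * sum v            ≈⟨ minus (sum u) (sum v) ⟨
    sum u - sum v                          ∎
    where
    minus : ∀ x y → x - y ≈ x + fromℤ ℤ.-1ℤ * y
    minus = solve 2 (λ x y → x :- y := x :+ con ℤ.-1ℤ :* y) refl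

  sum-δ : ∀ {m} (v : Vector Carrier m) i → sum (λ k → v k * fromℤ (δ k i)) ≈ v i
  sum-δ v zero = begin
    v zero * fromℤ (+ 1) + sum (λ k → v (suc k) * 0#)  ≈⟨ +-congˡ (sum-*0 (v ∘ suc)) ⟩
    v zero * fromℤ (+ 1) + 0#
      ≈⟨ solve 1 (λ x → x :* con (+ 1) :+ con (+ 0) := x) refl (v zero) ⟩
    v zero                                             ∎
  sum-δ v (suc i) = begin
    v zero * 0# + sum (λ k → v (suc k) * fromℤ (δ k i))  ≈⟨ +-cong (R.zeroʳ _) (sum-δ (v ∘ suc) i) ⟩
    0# + v (suc i)                                       ≈⟨ +-identityˡ _ ⟩
    v (suc i)                                            ∎

  -- An end facet lacks one of its two coordinates. The missing one contributes 0, which the zero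
  -- padding of `v` supplies, here at the first position and in `sum-δ-inject₁` at the last.
  sum-δ-suc : ∀ {m} (v : Vector Carrier m) k →
              sum (λ j → v j * fromℤ (δ k (suc j))) ≈ pad 0# v 0# (inject₁ k)
  sum-δ-suc v zero    = sum-*0 v
  sum-δ-suc v (suc i) = begin
    sum (λ j → v j * fromℤ (δ i j))  ≈⟨ sum-cong-≋ (λ j → *-congˡ (R.reflexive (≡.cong fromℤ (δ-sym i j)))) ⟩
    sum (λ j → v j * fromℤ (δ j i))  ≈⟨ sum-δ v i ⟩
    v i                              ≡⟨ snoc-inject₁ v 0# i ⟨
    snoc v 0# (inject₁ i)            ∎

  sum-δ-inject₁ : ∀ {m} (v : Vector Carrier m) k →
                  sum (λ j → v j * fromℤ (δ k (inject₁ j))) ≈ pad 0# v 0# (suc k)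
  sum-δ-inject₁ {zero}  v zero = refl
  sum-δ-inject₁ {suc m} v zero = begin
    v zero * fromℤ (+ 1) + sum (λ j → v (suc j) * 0#)  ≈⟨ +-congˡ (sum-*0 (v ∘ suc)) ⟩
    v zero * fromℤ (+ 1) + 0#
      ≈⟨ solve 1 (λ x → x :* con (+ 1) :+ con (+ 0) := x) refl (v zero) ⟩
    v zero                                             ∎
  sum-δ-inject₁ {suc m} v (suc k) = begin
    v zero * 0# + sum (λ j → v (suc j) * fromℤ (δ k (inject₁ j)))
      ≈⟨ +-cong (R.zeroʳ _) (sum-δ-inject₁ (v ∘ suc) k) ⟩
    0# + snoc (v ∘ suc) 0# k                                       ≈⟨ +-identityˡ _ ⟩
    snoc (v ∘ suc) 0# k                                            ∎

  ∙-combination : ∀ {d m} (x : Vector Carrier d) {y} (w : Vector Carrier m) v → _≋_ ℝ y (combination ℝ w v) →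
                  ⟨_,_⟩ ℝ x y ≈ sum (λ k → w k * ⟨_,_⟩ ℝ x (v k))
  ∙-combination x {y} w v y≋wv = begin
    sum (λ j → x j * y j)
      ≈⟨ sum-cong-≋ (λ j → *-congˡ (y≋wv j)) ⟩
    sum (λ j → x j * sum (λ k → w k * v k j))
      ≈⟨ sum-cong-≋ (λ j → *-distribˡ-sum (x j) (λ k → w k * v k j)) ⟩
    sum (λ j → sum (λ k → x j * (w k * v k j)))
      ≈⟨ ∑-comm (λ j k → x j * (w k * v k j)) ⟩
    sum (λ k → sum (λ j → x j * (w k * v k j)))
      ≈⟨ sum-cong-≋ (λ k → sum-cong-≋
        (λ j → solve 3 (λ x w v → x :* (w :* v) := w :* (x :* v)) refl (x j) (w k) (v k j))) ⟩
    sum (λ k → sum (λ j → w k * (x j * v k j)))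
      ≈⟨ sum-cong-≋ (λ k → *-distribˡ-sum (w k) (λ j → x j * v k j)) ⟨
    sum (λ k → w k * ⟨_,_⟩ ℝ x (v k)) ∎

  nonneg-sum-zero : ∀ {m} {v : Vector Carrier m} → (∀ k → 0# ≤ v k) → sum v ≈ 0# → ∀ k → v k ≈ 0#
  nonneg-sum-zero {suc m} {v} 0≤v ∑v≈0 = λ where
      zero    → ≤-antisym (≤-trans (x≤x+y 0≤∑′) (≈⇒≤ ∑v≈0)) (0≤v zero)
      (suc k) → nonneg-sum-zero (0≤v ∘ suc)
        (≤-antisym (≤-trans (≤-respʳ-≈ (+-comm _ _) (x≤x+y (0≤v zero))) (≈⇒≤ ∑v≈0)) 0≤∑′) k
    where
    0≤∑′ : 0# ≤ sum (v ∘ suc)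
    0≤∑′ = sum-nonneg (v ∘ suc) (0≤v ∘ suc)

slope-cong : ∀ {m} (σ : Vector ℤ (suc m)) {x y : Vector ℤ (suc m)} →
             (∀ i → x i ≡ y i) → ∀ k → slope σ x k ≡ slope σ y k
slope-cong σ x≗y k = ≡.cong₂ (λ a b → σ (inject₁ k) ℤ.* a ℤ.- σ (suc k) ℤ.* b) (x≗y (suc k)) (x≗y (inject₁ k))

slope-minus : ∀ {m} (σ x y : Vector ℤ (suc m)) k →
              slope σ (λ i → x i ℤ.- y i) k ≡ slope σ x k ℤ.- slope σ y k
slope-minus σ x y k = lemma (σ (inject₁ k)) (σ (suc k)) _ _ _ _
  where
  lemma : ∀ s t a b c d → s ℤ.* (a ℤ.- b) ℤ.- t ℤ.* (c ℤ.- d) ≡ (s ℤ.* a ℤ.- t ℤ.* c) ℤ.- (s ℤ.* b ℤ.- t ℤ.* d)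
  lemma = solve-∀

-- The dual of a padded simplex

module Simplex {c ℓ₁ ℓ₂} (ℝ : RealNumbers c ℓ₁ ℓ₂) {m} (σ : Vector ℤ (2 ℕ.+ m)) (0<σ : ∀ i → + 0 ℤ.< σ i)
  (σ-last : σ (fromℕ (suc m)) ≡ + 1) (q : Vector ℤ m) where

  open RealNumbers ℝ
  open OrderedField ℝ
  open Sums ℝ
  private module R = CommutativeRing commutativeRing
  open SetoidReasoning R.setoid

  κ : Vector ℤ (suc m)
  κ = slope σ (pad (+ 0) q (+ 1))

  -- The linear part of the facet functions around q. Both ends are padded by 0 because a
  -- displacement leaves the padding of a point fixed; the end value 1 is already counted in `κ`.
  L : Vector Carrier m → Vector Carrier (suc m)
  L x k = fromℤ (σ (inject₁ k)) * pad 0# x 0# (suc k) - fromℤ (σ (suc k)) * pad 0# x 0# (inject₁ k)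

  Polytope : Vector Carrier m → Set ℓ₂
  Polytope x = ∀ k → 0# ≤ fromℤ (κ k) + L x k

  L-embed : ∀ z k → L (embed ℝ z) k ≈ fromℤ (slope σ (pad (+ 0) z (+ 0)) k)
  L-embed z k = begin
    fromℤ (σ (inject₁ k)) * pad 0# (embed ℝ z) 0# (suc k)
      - fromℤ (σ (suc k)) * pad 0# (embed ℝ z) 0# (inject₁ k)
      ≡⟨ ≡.cong₂ (λ x y → fromℤ (σ (inject₁ k)) * x - fromℤ (σ (suc k)) * y) (pad-embed (suc k))
        (pad-embed (inject₁ k)) ⟩
    fromℤ (σ (inject₁ k)) * fromℤ (ẑ (suc k)) - fromℤ (σ (suc k)) * fromℤ (ẑ (inject₁ k))
      ≈⟨ +-cong (fromℤ-* (σ (inject₁ k)) (ẑ (suc k))) (-‿cong (fromℤ-* (σ (suc k)) (ẑ (inject₁ k)))) ⟨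
    fromℤ (σ (inject₁ k) ℤ.* ẑ (suc k)) - fromℤ (σ (suc k) ℤ.* ẑ (inject₁ k))
      ≈⟨ fromℤ-minus (σ (inject₁ k) ℤ.* ẑ (suc k)) (σ (suc k) ℤ.* ẑ (inject₁ k)) ⟨
    fromℤ (slope σ ẑ k) ∎
    where
    ẑ = pad (+ 0) z (+ 0)

    pad-embed : ∀ i → pad 0# (embed ℝ z) 0# i ≡ fromℤ (ẑ i)
    pad-embed = pad-lift (λ x y → x ≡ fromℤ y) ≡.refl (λ _ → ≡.refl) ≡.refl

  vertex : Fin (suc m) → Vector ℤ m
  vertex k j = cut k σ (suc (inject₁ j)) ℤ.- q j

  -- `vertex k` padded by zeros is `cut k σ` minus `q` padded by 0 and 1. At the last position the
  -- two cancel because `σ` ends in 1.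
  slope-vertex : ∀ k f → slope σ (pad (+ 0) (vertex k) (+ 0)) f
                         ≡ δ k f ℤ.* (σ (inject₁ f) ℤ.* σ (suc f)) ℤ.- κ f
  slope-vertex k f = ≡.trans
    (slope-cong σ (paddedCases (λ i → pad (+ 0) (vertex k) (+ 0) i ≡ cut k σ i ℤ.- q̂ i) ≡.refl inner last) f)
    (≡.trans (slope-minus σ (cut k σ) q̂ f) (≡.cong (ℤ._- κ f) (slope-cut k σ f)))
    where
    q̂ = pad (+ 0) q (+ 1)

    inner : ∀ j → snoc (vertex k) (+ 0) (inject₁ j) ≡ cut k σ (suc (inject₁ j)) ℤ.- snoc q (+ 1) (inject₁ j)
    inner j rewrite snoc-inject₁ (vertex k) (+ 0) j | snoc-inject₁ q (+ 1) j = ≡.refl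

    last : snoc (vertex k) (+ 0) (fromℕ m) ≡ cut k σ (suc (fromℕ m)) ℤ.- snoc q (+ 1) (fromℕ m)
    last rewrite snoc-fromℕ (vertex k) (+ 0) | snoc-fromℕ q (+ 1) | cut-fromℕ k σ | σ-last = ≡.refl

  L-vertex : ∀ k f → L (embed ℝ (vertex k)) f
                     ≈ fromℤ (δ k f) * (fromℤ (σ (inject₁ f)) * fromℤ (σ (suc f))) - fromℤ (κ f)
  L-vertex k f = begin
    L (embed ℝ (vertex k)) f
      ≈⟨ L-embed (vertex k) f ⟩
    fromℤ (slope σ (pad (+ 0) (vertex k) (+ 0)) f)
      ≡⟨ ≡.cong fromℤ (slope-vertex k f) ⟩
    fromℤ (δ k f ℤ.* (σ (inject₁ f) ℤ.* σ (suc f)) ℤ.- κ f)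
      ≈⟨ fromℤ-minus (δ k f ℤ.* (σ (inject₁ f) ℤ.* σ (suc f))) (κ f) ⟩
    fromℤ (δ k f ℤ.* (σ (inject₁ f) ℤ.* σ (suc f))) - fromℤ (κ f)
      ≈⟨ +-congʳ (trans (fromℤ-* (δ k f) _) (*-congˡ (fromℤ-* (σ (inject₁ f)) (σ (suc f))))) ⟩
    fromℤ (δ k f) * (fromℤ (σ (inject₁ f)) * fromℤ (σ (suc f))) - fromℤ (κ f) ∎

  vertex∈Polytope : ∀ k → Polytope (embed ℝ (vertex k))
  vertex∈Polytope k f = ≤-respʳ-≈
    (sym (trans (+-congˡ (L-vertex k f)) (solve 2 (λ x y → x :+ (y :- x) := y) refl _ _)))
    (*-mono-0≤ (0≤fromℤ (0≤δ k f)) (<⇒≤ (*-pos (0<fromℤ (0<σ (inject₁ f))) (0<fromℤ (0<σ (suc f))))))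

  infix 8 _∙_
  _∙_ : Vector Carrier m → Vector Carrier m → Carrier
  _∙_ = ⟨_,_⟩ ℝ

  -- The slack of `y` in the inequality that vertex `k` imposes on the dual.
  τ : Vector Carrier m → Vector Carrier (suc m)
  τ y k = 1# - embed ℝ (vertex k) ∙ y

  -- By `cut-inject₁` the two vertices differ in coordinate `j` alone, so the difference of the
  -- slacks isolates `y j`.
  τ-step : ∀ y j → τ y (suc j) - τ y (inject₁ j) ≈ fromℤ (σ (suc (inject₁ j))) * y j
  τ-step y j = begin
    (1# - embed ℝ (vertex (suc j)) ∙ y) - (1# - embed ℝ (vertex (inject₁ j)) ∙ y)
      ≈⟨ solve 3 (λ a b c → (a :- b) :- (a :- c) := c :- b) refl 1# _ _ ⟩
    embed ℝ (vertex (inject₁ j)) ∙ y - embed ℝ (vertex (suc j)) ∙ y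
      ≈⟨ sum-minus (λ i → fromℤ (vertex (inject₁ j) i) * y i) (λ i → fromℤ (vertex (suc j) i) * y i) ⟨
    sum (λ i → fromℤ (vertex (inject₁ j) i) * y i - fromℤ (vertex (suc j) i) * y i)
      ≈⟨ sum-cong-≋ coordinate ⟩
    sum (λ i → fromℤ (σ (suc (inject₁ i))) * y i * fromℤ (δ i j))
      ≈⟨ sum-δ (λ i → fromℤ (σ (suc (inject₁ i))) * y i) j ⟩
    fromℤ (σ (suc (inject₁ j))) * y j ∎
    where
    difference : ∀ i → vertex (inject₁ j) i ≡ vertex (suc j) i ℤ.+ δ i j ℤ.* σ (suc (inject₁ i))
    difference i = ≡.trans (≡.cong (ℤ._- q i) (cut-inject₁ j σ (suc (inject₁ i))))
      (≡.trans (≡.cong (λ d → cut (suc j) σ (suc (inject₁ i)) ℤ.+ d ℤ.* σ (suc (inject₁ i)) ℤ.- q i)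
                       (≡.trans (δ-inject₁ j i) (δ-sym j i)))
               (lemma (cut (suc j) σ (suc (inject₁ i))) (δ i j ℤ.* σ (suc (inject₁ i))) (q i)))
      where
      lemma : ∀ a b c → a ℤ.+ b ℤ.- c ≡ a ℤ.- c ℤ.+ b
      lemma = solve-∀

    coordinate : ∀ i → fromℤ (vertex (inject₁ j) i) * y i - fromℤ (vertex (suc j) i) * y i
                       ≈ fromℤ (σ (suc (inject₁ i))) * y i * fromℤ (δ i j)
    coordinate i = begin
      fromℤ (vertex (inject₁ j) i) * y i - fromℤ (vertex (suc j) i) * y i
        ≡⟨ ≡.cong (λ v → fromℤ v * y i - fromℤ (vertex (suc j) i) * y i) (difference i) ⟩
      fromℤ (vertex (suc j) i ℤ.+ δ i j ℤ.* σ (suc (inject₁ i))) * y i - fromℤ (vertex (suc j) i) * y i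
        ≈⟨ +-congʳ (*-congʳ (trans (fromℤ-+ (vertex (suc j) i) _) (+-congˡ (fromℤ-* (δ i j) _)))) ⟩
      (fromℤ (vertex (suc j) i) + fromℤ (δ i j) * fromℤ (σ (suc (inject₁ i)))) * y i
        - fromℤ (vertex (suc j) i) * y i
        ≈⟨ solve 4 (λ v d s y → (v :+ d :* s) :* y :- v :* y := s :* y :* d) refl _ _ _ _ ⟩
      fromℤ (σ (suc (inject₁ i))) * y i * fromℤ (δ i j) ∎

  -- `β` and `γ` are the quotients of σₖ and σₖ₊₁ by κₖ, given only through their equations. The
  -- same computations thus serve integer quotients, when divisibility is assumed, and quotients in
  -- the field, when it is to be proved.
  module Normals (0<κ : ∀ k → + 0 ℤ.< κ k) (β γ : Vector Carrier (suc m))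
    (κβ≈σ : ∀ k → fromℤ (κ k) * β k ≈ fromℤ (σ (inject₁ k)))
    (κγ≈σ : ∀ k → fromℤ (κ k) * γ k ≈ fromℤ (σ (suc k))) where

    normal : Fin (suc m) → Vector Carrier m
    normal k j = γ k * fromℤ (δ k (suc j)) - β k * fromℤ (δ k (inject₁ j))

    κ*∙-normal : ∀ x k → fromℤ (κ k) * (x ∙ normal k) ≈ - L x k
    κ*∙-normal x k = begin
      fromℤ (κ k) * (x ∙ normal k)
        ≈⟨ *-congˡ (sum-cong-≋ (λ j →
          solve 5 (λ x g b d e → x :* (g :* d :- b :* e) := g :* (x :* d) :- b :* (x :* e))
          refl (x j) (γ k) (β k) _ _)) ⟩
      fromℤ (κ k) * sum (λ j → γ k * (x j * fromℤ (δ k (suc j))) - β k * (x j * fromℤ (δ k (inject₁ j))))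
        ≈⟨ *-congˡ (sum-minus (λ j → γ k * (x j * fromℤ (δ k (suc j))))
          (λ j → β k * (x j * fromℤ (δ k (inject₁ j))))) ⟩
      fromℤ (κ k) * (sum (λ j → γ k * (x j * fromℤ (δ k (suc j))))
        - sum (λ j → β k * (x j * fromℤ (δ k (inject₁ j)))))
        ≈⟨ *-congˡ (+-cong (*-distribˡ-sum (γ k) (λ j → x j * fromℤ (δ k (suc j))))
          (-‿cong (*-distribˡ-sum (β k) (λ j → x j * fromℤ (δ k (inject₁ j)))))) ⟨
      fromℤ (κ k) * (γ k * sum (λ j → x j * fromℤ (δ k (suc j)))
        - β k * sum (λ j → x j * fromℤ (δ k (inject₁ j))))
        ≈⟨ *-congˡ (+-cong (*-congˡ (sum-δ-suc x k)) (-‿cong (*-congˡ (sum-δ-inject₁ x k)))) ⟩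
      fromℤ (κ k) * (γ k * pad 0# x 0# (inject₁ k) - β k * pad 0# x 0# (suc k))
        ≈⟨ solve 5 (λ k g b u v → k :* (g :* u :- b :* v) := (k :* g) :* u :- (k :* b) :* v) refl _ _ _ _ _ ⟩
      (fromℤ (κ k) * γ k) * pad 0# x 0# (inject₁ k) - (fromℤ (κ k) * β k) * pad 0# x 0# (suc k)
        ≈⟨ +-cong (*-congʳ (κγ≈σ k)) (-‿cong (*-congʳ (κβ≈σ k))) ⟩
      fromℤ (σ (suc k)) * pad 0# x 0# (inject₁ k) - fromℤ (σ (inject₁ k)) * pad 0# x 0# (suc k)
        ≈⟨ solve 2 (λ x y → x :- y := :- (y :- x)) refl _ _ ⟩
      - L x k ∎

    normal∈dual : ∀ k x → Polytope x → x ∙ normal k ≤ 1#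
    normal∈dual k x x∈P = 0≤y-x⇒x≤y (*-cancelˡ-0≤ (0<fromℤ (0<κ k)) (≤-respʳ-≈ (sym (begin
      fromℤ (κ k) * (1# - x ∙ normal k)             ≈⟨ x*[1-y]≈x-x*y (fromℤ (κ k)) (x ∙ normal k) ⟩
      fromℤ (κ k) - fromℤ (κ k) * (x ∙ normal k)    ≈⟨ +-congˡ (-‿cong (κ*∙-normal x k)) ⟩
      fromℤ (κ k) - (- L x k)                       ≈⟨ solve 2 (λ k l → k :- (:- l) := k :+ l) refl _ _ ⟩
      fromℤ (κ k) + L x k                           ∎)) (x∈P k)))

    -- This makes `normal k` a vertex of the dual: its slack vanishes at every `f` other than `k`,
    -- and its slack at `k` is the denominator in `weight`.
    κ*τ-normal : ∀ f k → fromℤ (κ k) * τ (normal k) f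
                         ≈ fromℤ (δ f k) * (fromℤ (σ (inject₁ k)) * fromℤ (σ (suc k)))
    κ*τ-normal f k = begin
      fromℤ (κ k) * (1# - embed ℝ (vertex f) ∙ normal k)
        ≈⟨ x*[1-y]≈x-x*y (fromℤ (κ k)) (embed ℝ (vertex f) ∙ normal k) ⟩
      fromℤ (κ k) - fromℤ (κ k) * (embed ℝ (vertex f) ∙ normal k)
        ≈⟨ +-congˡ (-‿cong (trans (κ*∙-normal _ k) (-‿cong (L-vertex f k)))) ⟩
      fromℤ (κ k) - (- (fromℤ (δ f k) * (fromℤ (σ (inject₁ k)) * fromℤ (σ (suc k))) - fromℤ (κ k)))
        ≈⟨ solve 2 (λ k d → k :- (:- (d :- k)) := d) refl _ _ ⟩
      fromℤ (δ f k) * (fromℤ (σ (inject₁ k)) * fromℤ (σ (suc k))) ∎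

    ρ : Vector Carrier (2 ℕ.+ m)
    ρ i = proj₁ (pos-inverse (0<fromℤ (0<σ i)))

    σρ≈1 : ∀ i → fromℤ (σ i) * ρ i ≈ 1#
    σρ≈1 i = proj₂ (pos-inverse (0<fromℤ (0<σ i)))

    -- Barycentric coordinates of `y` with respect to the normals: the slack `τ y k` divided by σₖ
    -- σₖ₊₁ / κₖ, the slack of `normal k` at the same vertex.
    weight : Vector Carrier m → Vector Carrier (suc m)
    weight y k = fromℤ (κ k) * (ρ (inject₁ k) * ρ (suc k)) * τ y k

    0≤weight : ∀ y k → 0# ≤ τ y k → 0# ≤ weight y k
    0≤weight y k = *-mono-0≤ (<⇒≤ (*-pos (0<fromℤ (0<κ k)) (*-pos (0<ρ (inject₁ k)) (0<ρ (suc k)))))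
      where
      0<ρ : ∀ i → 0# < ρ i
      0<ρ i = inverse-pos (0<fromℤ (0<σ i)) (σρ≈1 i)

    -- Coordinate `j` occurs only in the normals `inject₁ j` and `suc j`. In each, κ and the outer
    -- entry of σ cancel, which leaves the slack difference of `τ-step` divided by its factor.
    combination-normal : ∀ y j → combination ℝ (weight y) normal j ≈ y j
    combination-normal y j = begin
      sum (λ k → weight y k * normal k j)
        ≈⟨ sum-cong-≋ (λ k → solve 5 (λ w g b d e → w :* (g :* d :- b :* e) := (w :* g) :* d :- (w :* b) :* e)
          refl (weight y k) (γ k) (β k) (fromℤ (δ k (suc j))) (fromℤ (δ k (inject₁ j)))) ⟩
      sum (λ k → (weight y k * γ k) * fromℤ (δ k (suc j)) - (weight y k * β k) * fromℤ (δ k (inject₁ j)))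
        ≈⟨ sum-minus (λ k → (weight y k * γ k) * fromℤ (δ k (suc j)))
          (λ k → (weight y k * β k) * fromℤ (δ k (inject₁ j))) ⟩
      sum (λ k → (weight y k * γ k) * fromℤ (δ k (suc j)))
        - sum (λ k → (weight y k * β k) * fromℤ (δ k (inject₁ j)))
        ≈⟨ +-cong (sum-δ (λ k → weight y k * γ k) (suc j))
          (-‿cong (sum-δ (λ k → weight y k * β k) (inject₁ j))) ⟩
      weight y (suc j) * γ (suc j) - weight y (inject₁ j) * β (inject₁ j)
        ≈⟨ +-cong weight*γ (-‿cong weight*β) ⟩
      ρⱼ * τ y (suc j) - ρⱼ * τ y (inject₁ j)
        ≈⟨ solve 3 (λ r s t → r :* s :- r :* t := r :* (s :- t)) refl _ _ _ ⟩
      ρⱼ * (τ y (suc j) - τ y (inject₁ j))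
        ≈⟨ *-congˡ (τ-step y j) ⟩
      ρⱼ * (fromℤ (σ (suc (inject₁ j))) * y j)
        ≈⟨ solve 3 (λ r s y → r :* (s :* y) := (s :* r) :* y) refl _ _ _ ⟩
      fromℤ (σ (suc (inject₁ j))) * ρⱼ * y j
        ≈⟨ trans (*-congʳ (σρ≈1 _)) (*-identityˡ _) ⟩
      y j ∎
      where
      ρⱼ = ρ (suc (inject₁ j))

      weight*γ : weight y (suc j) * γ (suc j) ≈ ρⱼ * τ y (suc j)
      weight*γ = begin
        fromℤ (κ (suc j)) * (ρⱼ * ρ (suc (suc j))) * τ y (suc j) * γ (suc j)
          ≈⟨ solve 5 (λ k r r′ t g → k :* (r :* r′) :* t :* g := (k :* g) :* r′ :* (r :* t)) refl _ _ _ _ _ ⟩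
        (fromℤ (κ (suc j)) * γ (suc j)) * ρ (suc (suc j)) * (ρⱼ * τ y (suc j))
          ≈⟨ *-congʳ (trans (*-congʳ (κγ≈σ (suc j))) (σρ≈1 _)) ⟩
        1# * (ρⱼ * τ y (suc j))
          ≈⟨ *-identityˡ _ ⟩
        ρⱼ * τ y (suc j) ∎

      weight*β : weight y (inject₁ j) * β (inject₁ j) ≈ ρⱼ * τ y (inject₁ j)
      weight*β = begin
        fromℤ (κ (inject₁ j)) * (ρ (inject₁ (inject₁ j)) * ρⱼ) * τ y (inject₁ j) * β (inject₁ j)
          ≈⟨ solve 5 (λ k r r′ t b → k :* (r :* r′) :* t :* b := (k :* b) :* r :* (r′ :* t)) refl _ _ _ _ _ ⟩
        (fromℤ (κ (inject₁ j)) * β (inject₁ j)) * ρ (inject₁ (inject₁ j)) * (ρⱼ * τ y (inject₁ j))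
          ≈⟨ *-congʳ (trans (*-congʳ (κβ≈σ (inject₁ j))) (σρ≈1 _)) ⟩
        1# * (ρⱼ * τ y (inject₁ j))
          ≈⟨ *-identityˡ _ ⟩
        ρⱼ * τ y (inject₁ j) ∎

    -- A vertex pairs to 1 with every normal except the one of its own index; the defect there,
    -- multiplied by the weight, is exactly `τ y f`.
    vertex∙y : ∀ y f → embed ℝ (vertex f) ∙ y ≈ sum (weight y) - τ y f
    vertex∙y y f = begin
      sum (λ j → v j * y j)
        ≈⟨ ∙-combination v (weight y) normal (λ j → sym (combination-normal y j)) ⟩
      sum (λ k → weight y k * (v ∙ normal k))
        ≈⟨ sum-cong-≋ term ⟩
      sum (λ k → weight y k - τ y k * fromℤ (δ k f))
        ≈⟨ sum-minus (weight y) (λ k → τ y k * fromℤ (δ k f)) ⟩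
      sum (weight y) - sum (λ k → τ y k * fromℤ (δ k f))
        ≈⟨ +-congˡ (-‿cong (sum-δ (τ y) f)) ⟩
      sum (weight y) - τ y f ∎
      where
      v = embed ℝ (vertex f)

      term : ∀ k → weight y k * (v ∙ normal k) ≈ weight y k - τ y k * fromℤ (δ k f)
      term k = begin
        κₖ * (r * r′) * t * (v ∙ normal k)
          ≈⟨ solve 5 (λ k r r′ t x → k :* (r :* r′) :* t :* x := (r :* r′) :* t :* (k :* x))
            refl κₖ r r′ t (v ∙ normal k) ⟩
        (r * r′) * t * (κₖ * (v ∙ normal k))
          ≈⟨ *-congˡ (trans (κ*∙-normal v k) (-‿cong (L-vertex f k))) ⟩
        (r * r′) * t * (- (fromℤ (δ f k) * (s * s′) - κₖ))
          ≈⟨ solve 7 (λ k r r′ t d s s′ → (r :* r′) :* t :* (:- (d :* (s :* s′) :- k)) := k :* (r :* r′) :* t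
            :- (s :* r) :* (s′ :* r′) :* (t :* d)) refl κₖ r r′ t (fromℤ (δ f k)) s s′ ⟩
        κₖ * (r * r′) * t - (s * r) * (s′ * r′) * (t * fromℤ (δ f k))
          ≈⟨ +-congˡ (-‿cong (*-congʳ (trans (*-cong (σρ≈1 _) (σρ≈1 _)) (*-identityˡ _)))) ⟩
        κₖ * (r * r′) * t - 1# * (t * fromℤ (δ f k))
          ≈⟨ +-congˡ (-‿cong (*-identityˡ _)) ⟩
        κₖ * (r * r′) * t - t * fromℤ (δ f k)
          ≡⟨ ≡.cong (λ d → κₖ * (r * r′) * t - t * fromℤ d) (δ-sym f k) ⟩
        κₖ * (r * r′) * t - t * fromℤ (δ k f) ∎
        where
        κₖ = fromℤ (κ k)
        r = ρ (inject₁ k)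
        r′ = ρ (suc k)
        s = fromℤ (σ (inject₁ k))
        s′ = fromℤ (σ (suc k))
        t = τ y k

    -- Evaluating y = Σ wₖ aₖ at a vertex avoids telescoping the weights.
    sum-weight : ∀ y → sum (weight y) ≈ 1#
    sum-weight y = begin
      sum (weight y)
        ≈⟨ solve 2 (λ w t → w := (w :- t) :+ t) refl _ (τ y zero) ⟩
      (sum (weight y) - τ y zero) + τ y zero                      ≈⟨ +-congʳ (vertex∙y y zero) ⟨
      embed ℝ (vertex zero) ∙ y + (1# - embed ℝ (vertex zero) ∙ y)
        ≈⟨ solve 2 (λ x u → x :+ (u :- x) := u) refl _ 1# ⟩
      1# ∎

-- Integrality of the dual and divisibility

module DualSimplex {c ℓ₁ ℓ₂} (ℝ : RealNumbers c ℓ₁ ℓ₂) {m} (σ : Vector ℤ (2 ℕ.+ m)) (0<σ : ∀ i → + 0 ℤ.< σ i)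
  (σ-last : σ (fromℕ (suc m)) ≡ + 1) (q : Vector ℤ m)
  (0<κ : ∀ k → + 0 ℤ.< Simplex.κ ℝ σ 0<σ σ-last q k)
  {ℓ} (Q : Pred (Vector (RealNumbers.Carrier ℝ) m) ℓ)
  (Q≐ : Q ≐ Simplex.Polytope ℝ σ 0<σ σ-last q) where

  open RealNumbers ℝ
  open OrderedField ℝ
  open Sums ℝ
  open Simplex ℝ σ 0<σ σ-last q
  private module R = CommutativeRing commutativeRing
  open SetoidReasoning R.setoid

  0≤τ : ∀ {y} → Dual ℝ Q y → ∀ f → 0# ≤ τ y f
  0≤τ y∈Q* f = x≤y⇒0≤y-x (y∈Q* _ (proj₂ Q≐ (vertex∈Polytope f)))

  dual-latticePolytope : (∀ k → ∃ λ b → κ k ℤ.* b ≡ σ (inject₁ k)) →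
                         (∀ k → ∃ λ g → κ k ℤ.* g ≡ σ (suc k)) →
                         LatticePolytope ℝ (Dual ℝ Q)
  dual-latticePolytope κ∣σ κ∣σ′ = suc m , normalℤ , dual⊆hull , hull⊆dual
    where
    b = λ k → proj₁ (κ∣σ k)
    g = λ k → proj₁ (κ∣σ′ k)

    normalℤ : Fin (suc m) → Vector ℤ m
    normalℤ k j = g k ℤ.* δ k (suc j) ℤ.- b k ℤ.* δ k (inject₁ j)

    open Normals 0<κ (fromℤ ∘ b) (fromℤ ∘ g)
      (λ k → trans (sym (fromℤ-* (κ k) (b k))) (R.reflexive (≡.cong fromℤ (proj₂ (κ∣σ k)))))
      (λ k → trans (sym (fromℤ-* (κ k) (g k))) (R.reflexive (≡.cong fromℤ (proj₂ (κ∣σ′ k)))))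

    embed-normalℤ : ∀ k j → embed ℝ (normalℤ k) j ≈ normal k j
    embed-normalℤ k j = trans (fromℤ-minus (g k ℤ.* δ k (suc j)) (b k ℤ.* δ k (inject₁ j)))
      (+-cong (fromℤ-* (g k) (δ k (suc j))) (-‿cong (fromℤ-* (b k) (δ k (inject₁ j)))))

    dual⊆hull : Dual ℝ Q ⊆ ConvexHull ℝ (embed ℝ ∘ normalℤ)
    -- The slacks of a point of the dual are nonnegative, so its barycentric coordinates are convex
    -- weights.
    dual⊆hull {y} y∈Q* = weight y , (λ k → 0≤weight y k (0≤τ y∈Q* k)) , sum-weight y , λ j → begin
      y j                                                 ≈⟨ combination-normal y j ⟨
      combination ℝ (weight y) normal j
        ≈⟨ sum-cong-≋ (λ k → *-congˡ {x = weight y k} (embed-normalℤ k j)) ⟨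
      combination ℝ (weight y) (embed ℝ ∘ normalℤ) j      ∎

    hull⊆dual : ConvexHull ℝ (embed ℝ ∘ normalℤ) ⊆ Dual ℝ Q
    -- The slack of a convex combination is the same combination of the slacks.
    hull⊆dual {y} (w , 0≤w , ∑w≈1 , y≋) x x∈Q = 0≤y-x⇒x≤y (≤-respʳ-≈ (begin
      sum (λ k → w k * (1# - x ∙ normal k))
        ≈⟨ sum-cong-≋ (λ k → x*[1-y]≈x-x*y (w k) (x ∙ normal k)) ⟩
      sum (λ k → w k - w k * (x ∙ normal k))
        ≈⟨ sum-minus w (λ k → w k * (x ∙ normal k)) ⟩
      sum w - sum (λ k → w k * (x ∙ normal k))
        ≈⟨ +-cong ∑w≈1 (-‿cong (sym
          (∙-combination x w normal (λ j →
          trans (y≋ j) (sum-cong-≋ (λ k → *-congˡ {x = w k} (embed-normalℤ k j))))))) ⟩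
      1# - x ∙ y ∎)
      (sum-nonneg (λ k → w k * (1# - x ∙ normal k)) λ k →
        *-mono-0≤ (0≤w k) (x≤y⇒0≤y-x (normal∈dual k x (proj₁ Q≐ x∈Q)))))

  *-cancelˡ-≈0 : ∀ {x y} → 0# < x → x * y ≈ 0# → y ≈ 0#
  *-cancelˡ-≈0 {x} {y} 0<x x*y≈0 = begin
    y              ≈⟨ *-identityˡ y ⟨
    1# * y         ≈⟨ *-congʳ (proj₂ (pos-inverse 0<x)) ⟨
    x * x⁻¹ * y    ≈⟨ solve 3 (λ x z y → x :* z :* y := z :* (x :* y)) refl x x⁻¹ y ⟩
    x⁻¹ * (x * y)  ≈⟨ *-congˡ x*y≈0 ⟩
    x⁻¹ * 0#       ≈⟨ R.zeroʳ _ ⟩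
    0#             ∎
    where
    x⁻¹ = proj₁ (pos-inverse 0<x)

  τ-combination : ∀ {l} {y} (w : Vector Carrier l) v → sum w ≈ 1# → _≋_ ℝ y (combination ℝ w v) →
                  ∀ f → τ y f ≈ sum (λ i → w i * τ (v i) f)
  τ-combination {y = y} w v ∑w≈1 y≋ f = begin
    1# - u ∙ y
      ≈⟨ +-cong (sym ∑w≈1) (-‿cong (∙-combination u w v y≋)) ⟩
    sum w - sum (λ i → w i * (u ∙ v i))
      ≈⟨ sum-minus w (λ i → w i * (u ∙ v i)) ⟨
    sum (λ i → w i - w i * (u ∙ v i))
      ≈⟨ sum-cong-≋ (λ i → x*[1-y]≈x-x*y (w i) (u ∙ v i)) ⟨
    sum (λ i → w i * (1# - u ∙ v i)) ∎
    where
    u = embed ℝ (vertex f)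

  module Extremal (β γ : Vector Carrier (suc m))
    (κβ≈σ : ∀ k → fromℤ (κ k) * β k ≈ fromℤ (σ (inject₁ k)))
    (κγ≈σ : ∀ k → fromℤ (κ k) * γ k ≈ fromℤ (σ (suc k))) where

    open Normals 0<κ β γ κβ≈σ κγ≈σ public

    -- If no slack is left off `k`, then no weight is left off `k` either, and the weight at `k` is
    -- 1 because all of them sum to 1.
    normal-unique : ∀ k y → (∀ {f} → f ≢ k → τ y f ≈ 0#) → _≋_ ℝ y (normal k)
    normal-unique k y τ≈0 j = begin
        y j
          ≈⟨ combination-normal y j ⟨
        sum (λ f → weight y f * normal f j)
          ≈⟨ sum-cong-≋ (λ f → trans (*-congʳ (weight-off-k f))
            (solve 3 (λ w d a → w :* d :* a := w :* a :* d) refl (weight y f) (fromℤ (δ f k)) (normal f j))) ⟩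
        sum (λ f → weight y f * normal f j * fromℤ (δ f k))
          ≈⟨ sum-δ (λ f → weight y f * normal f j) k ⟩
        weight y k * normal k j
          ≈⟨ trans (*-congʳ weight-k) (*-identityˡ (normal k j)) ⟩
        normal k j ∎
      where
      weight-off-k : ∀ f → weight y f ≈ weight y f * fromℤ (δ f k)
      weight-off-k f with f Fin.≟ k
      ... | yes ≡.refl = sym (trans (*-congˡ (trans (R.reflexive (≡.cong fromℤ (δ-refl f))) fromℤ-1))
        (*-identityʳ (weight y f)))
      ... | no f≢k     = trans weight≈0 (sym (trans (*-congʳ weight≈0) (R.zeroˡ (fromℤ (δ f k)))))
        where
        weight≈0 : weight y f ≈ 0#
        weight≈0 = trans (*-congˡ (τ≈0 f≢k)) (R.zeroʳ _)

      weight-k : weight y k ≈ 1#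
      weight-k = begin
        weight y k                                ≈⟨ sum-δ (weight y) k ⟨
        sum (λ f → weight y f * fromℤ (δ f k))    ≈⟨ sum-cong-≋ weight-off-k ⟨
        sum (weight y)                            ≈⟨ sum-weight y ⟩
        1#                                        ∎

    -- τ vanishes at normal k off k, hence at every point used with positive weight.
    normal-extremal : ∀ k {l} (w : Vector Carrier l) v → (∀ i → 0# ≤ w i) → sum w ≈ 1# →
                      _≋_ ℝ (normal k) (combination ℝ w v) → (∀ i → Dual ℝ Q (v i)) →
                      ∀ i → 0# < w i → _≋_ ℝ (v i) (normal k)
    normal-extremal k w v 0≤w ∑w≈1 normal≋ v∈Q* i 0<wᵢ = normal-unique k (v i) λ {f} f≢k →
      *-cancelˡ-≈0 0<wᵢ (nonneg-sum-zero {v = λ i → w i * τ (v i) f}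
        (λ i → *-mono-0≤ (0≤w i) (0≤τ (v∈Q* i) f))
        (trans (sym (τ-combination w v ∑w≈1 normal≋ f)) (τ-normal≈0 f≢k)) i)
      where
      τ-normal≈0 : ∀ {f} → f ≢ k → τ (normal k) f ≈ 0#
      τ-normal≈0 {f} f≢k = *-cancelˡ-≈0 (0<fromℤ (0<κ k)) (trans (κ*τ-normal f k)
        (trans (*-congʳ (R.reflexive (≡.cong fromℤ (δ-≢ f≢k)))) (R.zeroˡ _)))

    -- `normal k` lies in the dual, hence is a convex combination of the given lattice points.
    -- `sum-pos` selects one of positive weight, and by extremality that point is `normal k`.
    normal-integral : LatticePolytope ℝ (Dual ℝ Q) → ∀ k → ∃ λ z → _≋_ ℝ (embed ℝ z) (normal k)
    normal-integral (l , v , dual⊆hull , hull⊆dual) k = extremal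
      (dual⊆hull (λ x x∈Q → normal∈dual k x (proj₁ Q≐ x∈Q)))
      where
      v∈Q* : ∀ i → Dual ℝ Q (embed ℝ (v i))
      -- Each generator lies in its own hull, by the weights concentrated at `i`.
      v∈Q* i = hull⊆dual (u , (λ i′ → 0≤fromℤ (0≤δ i′ i)) , ∑u≈1 , λ j → sym (begin
          sum (λ i′ → u i′ * embed ℝ (v i′) j)   ≈⟨ sum-cong-≋ (λ i′ → *-comm (u i′) _) ⟩
          sum (λ i′ → embed ℝ (v i′) j * u i′)   ≈⟨ sum-δ (λ i′ → embed ℝ (v i′) j) i ⟩
          embed ℝ (v i) j                        ∎))
        where
        u : Vector Carrier l
        u i′ = fromℤ (δ i′ i)

        ∑u≈1 : sum u ≈ 1#
        ∑u≈1 = trans (sum-cong-≋ (λ i′ → sym (*-identityˡ (u i′)))) (sum-δ (λ _ → 1#) i)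

      extremal : ConvexHull ℝ (embed ℝ ∘ v) (normal k) → ∃ λ z → _≋_ ℝ (embed ℝ z) (normal k)
      extremal (w , 0≤w , ∑w≈1 , normal≋) =
        let i , 0<wᵢ = sum-pos w (<-respʳ-≈ (sym ∑w≈1) 0<1)
        in v i , normal-extremal k w (embed ℝ ∘ v) 0≤w ∑w≈1 normal≋ v∈Q* i 0<wᵢ

    normal-suc : ∀ j → normal (suc j) j ≈ γ (suc j)
    normal-suc j = begin
      γ (suc j) * fromℤ (δ j j) - β (suc j) * fromℤ (δ (suc j) (inject₁ j))
        ≡⟨ ≡.cong₂ (λ d e → γ (suc j) * fromℤ d - β (suc j) * fromℤ e) (δ-refl j) (δ-suc-inject₁ j) ⟩
      γ (suc j) * fromℤ (+ 1) - β (suc j) * 0#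
        ≈⟨ solve 2 (λ g b → g :* con (+ 1) :- b :* con (+ 0) := g) refl (γ (suc j)) (β (suc j)) ⟩
      γ (suc j) ∎

    -- Entry `j` of the integral vector `normal (suc j)` is `γ (suc j)`, the quotient in question.
    κ∣σ : LatticePolytope ℝ (Dual ℝ Q) → ∀ j → ∃ λ z → κ (suc j) ℤ.* z ≡ σ (suc (suc j))
    κ∣σ lattice j = let z , z≋normal = normal-integral lattice (suc j) in z j , fromℤ-injective (begin
      fromℤ (κ (suc j) ℤ.* z j)               ≈⟨ fromℤ-* (κ (suc j)) (z j) ⟩
      fromℤ (κ (suc j)) * fromℤ (z j)         ≈⟨ *-congˡ (trans (z≋normal j) (normal-suc j)) ⟩
      fromℤ (κ (suc j)) * γ (suc j)           ≈⟨ κγ≈σ (suc j) ⟩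
      fromℤ (σ (suc (suc j)))                 ∎)

  κ∣σ-of-latticePolytope : LatticePolytope ℝ (Dual ℝ Q) → ∀ j →
                           ∃ λ z → κ (suc j) ℤ.* z ≡ σ (suc (suc j))
  κ∣σ-of-latticePolytope = Extremal.κ∣σ (λ f → κ⁻¹ f * fromℤ (σ (inject₁ f))) (λ f → κ⁻¹ f * fromℤ (σ (suc f)))
    (λ f → κκ⁻¹x≈x f _) (λ f → κκ⁻¹x≈x f _)
    where
    κ⁻¹ : Vector Carrier (suc m)
    κ⁻¹ f = proj₁ (pos-inverse (0<fromℤ (0<κ f)))

    κκ⁻¹x≈x : ∀ f x → fromℤ (κ f) * (κ⁻¹ f * x) ≈ x
    κκ⁻¹x≈x f x = trans (sym (*-assoc _ _ x))
      (trans (*-congʳ (proj₂ (pos-inverse (0<fromℤ (0<κ f))))) (*-identityˡ x))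

-- A padded unit vector is again a unit vector, so a step along coordinate `j` raises facet
-- `inject₁ j`, lowers facet `suc j` and leaves the others unchanged.
slope-δ : ∀ {m} (σ : Vector ℤ (2 ℕ.+ m)) j k →
          slope σ (pad (+ 0) (δ j) (+ 0)) k
          ≡ σ (inject₁ k) ℤ.* δ (inject₁ j) k ℤ.- σ (suc k) ℤ.* δ (suc j) k
slope-δ {m} σ j k = ≡.trans
  (slope-cong σ {y = δ (suc (inject₁ j))}
    (paddedCases (λ i → pad (+ 0) (δ j) (+ 0) i ≡ δ (suc (inject₁ j)) i) ≡.refl inner last) k)
  (≡.cong (λ d → σ (inject₁ k) ℤ.* δ (inject₁ j) k ℤ.- σ (suc k) ℤ.* d) (δ-inject₁ (suc j) k))
  where
  inner : ∀ i → snoc (δ j) (+ 0) (inject₁ i) ≡ δ (inject₁ j) (inject₁ i)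
  inner i = ≡.trans (snoc-inject₁ (δ j) (+ 0) i) (≡.sym (δ-inject₁ j i))

  last : snoc (δ j) (+ 0) (fromℕ m) ≡ δ (inject₁ j) (fromℕ m)
  last = ≡.trans (snoc-fromℕ (δ j) (+ 0)) (≡.sym (δ-inject₁-fromℕ j))

slope-neg : ∀ {m} (σ : Vector ℤ (2 ℕ.+ m)) (z : Vector ℤ m) k →
            slope σ (pad (+ 0) (ℤ.-_ ∘ z) (+ 0)) k ≡ ℤ.- slope σ (pad (+ 0) z (+ 0)) k
slope-neg σ z k = ≡.trans (slope-cong σ {y = ℤ.-_ ∘ pad (+ 0) z (+ 0)}
  (pad-lift (λ x y → x ≡ ℤ.- y) ≡.refl (λ _ → ≡.refl) ≡.refl) k)
  (lemma (σ (inject₁ k)) (σ (suc k)) _ _)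
  where
  lemma : ∀ s t a b → s ℤ.* (ℤ.- a) ℤ.- t ℤ.* (ℤ.- b) ≡ ℤ.- (s ℤ.* a ℤ.- t ℤ.* b)
  lemma = solve-∀

i<j⇒0<j-i : ∀ {i j} → i ℤ.< j → + 0 ℤ.< j ℤ.- i
i<j⇒0<j-i {i} {j} i<j = ≡.subst (ℤ._< j ℤ.- i) (ℤ.+-inverseʳ i) (ℤ.+-monoˡ-< (ℤ.- i) i<j)

0≤*0≤ : ∀ {a b} → + 0 ℤ.≤ a → + 0 ℤ.≤ b → + 0 ℤ.≤ a ℤ.* b
0≤*0≤ {+ m} {+ n} _ _ = ≡.subst (+ 0 ℤ.≤_) (ℤ.pos-* m n) (ℤ.+≤+ ℕ.z≤n)

-- The interior lattice point

module UnitPerturbation {m} (σ : Vector ℤ (2 ℕ.+ m)) (0<σ : ∀ i → + 0 ℤ.< σ i)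
  (κ : Vector ℤ (suc m)) (0<κ : ∀ k → + 0 ℤ.< κ k)
  (unique : ∀ z → (∀ k → + 0 ℤ.< κ k ℤ.+ slope σ (pad (+ 0) z (+ 0)) k) → ∀ j → z j ≡ + 0) where

  -- Otherwise `δ j` would be a second interior lattice point: only facet `suc j` loses when
  -- coordinate `j` grows, and its loss is exactly the right-hand side.
  κ-suc≤σ : ∀ j → κ (suc j) ℤ.≤ σ (suc (suc j))
  κ-suc≤σ j = ℤ.≮⇒≥ λ σ<κ → contradiction (≡.trans (≡.sym (δ-refl j)) (unique (δ j) (positive σ<κ) j)) λ()
    where
    positive : σ (suc (suc j)) ℤ.< κ (suc j) → ∀ k → + 0 ℤ.< κ k ℤ.+ slope σ (pad (+ 0) (δ j) (+ 0)) k
    positive σ<κ k rewrite slope-δ σ j k with k Fin.≟ suc j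
    ... | yes ≡.refl rewrite δ-refl j = ≡.subst (+ 0 ℤ.<_)
      (lemma (κ k) (σ (suc k)) (σ (inject₁ k) ℤ.* δ (inject₁ j) k))
      (ℤ.+-mono-<-≤ (i<j⇒0<j-i σ<κ) (0≤*0≤ (ℤ.<⇒≤ (0<σ (inject₁ k))) (0≤δ (inject₁ j) k)))
      where
      lemma : ∀ a b c → a ℤ.- b ℤ.+ c ≡ a ℤ.+ (c ℤ.- b ℤ.* + 1)
      lemma = solve-∀
    ... | no k≢sucj rewrite δ-≢ (k≢sucj ∘ ≡.sym) = ≡.subst (+ 0 ℤ.<_)
      (lemma (κ k) (σ (suc k)) (σ (inject₁ k) ℤ.* δ (inject₁ j) k))
      (ℤ.+-mono-<-≤ (0<κ k) (0≤*0≤ (ℤ.<⇒≤ (0<σ (inject₁ k))) (0≤δ (inject₁ j) k)))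
      where
      lemma : ∀ a b c → a ℤ.+ c ≡ a ℤ.+ (c ℤ.- b ℤ.* + 0)
      lemma = solve-∀

  -- The mirror image, with -eⱼ: now only facet `inject₁ j` loses.
  κ-inject₁≤σ : ∀ j → κ (inject₁ j) ℤ.≤ σ (inject₁ (inject₁ j))
  κ-inject₁≤σ j = ℤ.≮⇒≥ λ σ<κ →
    contradiction (≡.trans (≡.cong ℤ.-_ (≡.sym (δ-refl j))) (unique (ℤ.-_ ∘ δ j) (positive σ<κ) j)) λ()
    where
    positive : σ (inject₁ (inject₁ j)) ℤ.< κ (inject₁ j) →
               ∀ k → + 0 ℤ.< κ k ℤ.+ slope σ (pad (+ 0) (ℤ.-_ ∘ δ j) (+ 0)) k
    positive σ<κ k rewrite slope-neg σ (δ j) k | slope-δ σ j k with k Fin.≟ inject₁ j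
    ... | yes ≡.refl rewrite δ-refl (inject₁ j) = ≡.subst (+ 0 ℤ.<_)
      (lemma (κ k) (σ (inject₁ k)) (σ (suc k) ℤ.* δ (suc j) k))
      (ℤ.+-mono-<-≤ (i<j⇒0<j-i σ<κ) (0≤*0≤ (ℤ.<⇒≤ (0<σ (suc k))) (0≤δ (suc j) k)))
      where
      lemma : ∀ a b c → a ℤ.- b ℤ.+ c ≡ a ℤ.+ ℤ.- (b ℤ.* + 1 ℤ.- c)
      lemma = solve-∀
    ... | no k≢j rewrite δ-≢ (k≢j ∘ ≡.sym) = ≡.subst (+ 0 ℤ.<_)
      (lemma (κ k) (σ (inject₁ k)) (σ (suc k) ℤ.* δ (suc j) k))
      (ℤ.+-mono-<-≤ (0<κ k) (0≤*0≤ (ℤ.<⇒≤ (0<σ (suc k))) (0≤δ (suc j) k)))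
      where
      lemma : ∀ a b c → a ℤ.+ c ≡ a ℤ.+ ℤ.- (b ℤ.* + 0 ℤ.- c)
      lemma = solve-∀

-- The sum of the entries serves as the bound, since all of them are positive.
upperBound : ∀ {l} (σ : Vector ℤ l) → (∀ i → + 0 ℤ.< σ i) → ∃ λ N → + 0 ℤ.≤ N × ∀ i → σ i ℤ.≤ N
upperBound {zero}  σ 0<σ = + 0 , ℤ.≤-refl , λ ()
upperBound {suc l} σ 0<σ =
  let N , 0≤N , σ≤N = upperBound (σ ∘ suc) (0<σ ∘ suc)
  in σ zero ℤ.+ N , ℤ.+-mono-≤ (ℤ.<⇒≤ (0<σ zero)) 0≤N , λ where
       zero    → ≡.subst (ℤ._≤ σ zero ℤ.+ N) (ℤ.+-identityʳ _) (ℤ.+-monoʳ-≤ (σ zero) 0≤N)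
       (suc i) → ≡.subst (ℤ._≤ σ zero ℤ.+ N) (ℤ.+-identityˡ _) (ℤ.+-mono-≤ (ℤ.<⇒≤ (0<σ zero)) (σ≤N i))

module FanoSimplex {c ℓ₁ ℓ₂} (ℝ : RealNumbers c ℓ₁ ℓ₂) {m} (σ : Vector ℤ (2 ℕ.+ m)) (0<σ : ∀ i → + 0 ℤ.< σ i)
  (σ-last : σ (fromℕ (suc m)) ≡ + 1) (q : Vector ℤ m)
  {ℓ} (Q : Pred (Vector (RealNumbers.Carrier ℝ) m) ℓ)
  (Q≐ : Q ≐ Simplex.Polytope ℝ σ 0<σ σ-last q)
  (fano : (Interior ℝ Q ∩ Lattice ℝ) ≐ Origin ℝ) where

  open RealNumbers ℝ
  open OrderedField ℝ
  open Simplex ℝ σ 0<σ σ-last q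
  private module R = CommutativeRing commutativeRing
  open SetoidReasoning R.setoid

  -- The origin is interior, so a small positive multiple h of `z` still lies in `Q`, and κₖ + h ·
  -- slope ≥ 0. A negative slope then forces κₖ to be positive.
  slope<0⇒0<κ : ∀ z → (∀ j → ℤ.- (+ 1) ℤ.≤ z j) → (∀ j → z j ℤ.≤ + 1) →
                ∀ k → slope σ (pad (+ 0) z (+ 0)) k ℤ.< + 0 → + 0 ℤ.< κ k
  slope<0⇒0<κ z -1≤z z≤1 k slope<0 with proj₁ (proj₂ fano {λ _ → 0#} (λ _ → refl))
  ... | ε , 0<ε , box⊆Q = 0<fromℤ⁻¹
    (<-respʳ-≈ (solve 3 (λ k s h → :- s :* h :+ (k :+ s :* h) := k) refl _ (fromℤ (slope σ ẑ k)) h)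
      (+-mono-0<-0≤ (*-pos (<-respʳ-≈ (fromℤ-neg (slope σ ẑ k)) (0<fromℤ (ℤ.neg-mono-< slope<0))) 0<h)
        (≤-respʳ-≈ (+-congˡ L-y) (proj₁ Q≐ (box⊆Q y y∈box) k))))
    where
    ẑ = pad (+ 0) z (+ 0)
    -- The multiple is ε/2, so that entries between -1 and 1 stay strictly inside the open box.
    half = proj₁ (pos-inverse (0<suc 1))
    h = ε * half

    0<h : 0# < h
    0<h = *-pos 0<ε (inverse-pos (0<suc 1) (proj₂ (pos-inverse (0<suc 1))))

    ε≈h+h : ε ≈ h + h
    ε≈h+h = begin
      ε                        ≈⟨ *-identityʳ ε ⟨
      ε * 1#                   ≈⟨ *-congˡ (proj₂ (pos-inverse (0<suc 1))) ⟨
      ε * (fromℤ (+ 2) * half) ≈⟨ solve 2 (λ e h → e :* (con (+ 2) :* h) := e :* h :+ e :* h) refl ε half ⟩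
      h + h                    ∎

    y : Vector Carrier m
    y j = fromℤ (z j) * h

    y∈box : ∀ j → Within ε (y j) 0#
    y∈box j = 0<y-x⇒x<y (<-respʳ-≈ lower
      (+-mono-0<-0≤ 0<h (*-mono-0≤ (0≤fromℤ (ℤ.i≤j⇒0≤j-i (-1≤z j))) (<⇒≤ 0<h))))
      , 0<y-x⇒x<y (<-respʳ-≈ upper
      (+-mono-0<-0≤ 0<h (*-mono-0≤ (0≤fromℤ (ℤ.i≤j⇒0≤j-i (z≤1 j))) (<⇒≤ 0<h))))
      where
      lower : h + fromℤ (z j ℤ.- ℤ.- (+ 1)) * h ≈ y j - 0# - (- ε)
      lower = begin
        h + fromℤ (z j ℤ.- ℤ.- (+ 1)) * h              ≈⟨ +-congˡ (*-congʳ (fromℤ-minus (z j) (ℤ.- (+ 1)))) ⟩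
        h + (fromℤ (z j) - fromℤ (ℤ.- (+ 1))) * h
          ≈⟨ solve 2 (λ z h → h :+ (z :- con (ℤ.- (+ 1))) :* h := z :* h :- con (+ 0) :- (:- (h :+ h)))
            refl (fromℤ (z j)) h ⟩
        y j - 0# - (- (h + h))                         ≈⟨ +-congˡ (-‿cong (-‿cong ε≈h+h)) ⟨
        y j - 0# - (- ε)                               ∎

      upper : h + fromℤ (+ 1 ℤ.- z j) * h ≈ ε - (y j - 0#)
      upper = begin
        h + fromℤ (+ 1 ℤ.- z j) * h               ≈⟨ +-congˡ (*-congʳ (fromℤ-minus (+ 1) (z j))) ⟩
        h + (fromℤ (+ 1) - fromℤ (z j)) * h
          ≈⟨ solve 2 (λ z h → h :+ (con (+ 1) :- z) :* h := (h :+ h) :- (z :* h :- con (+ 0)))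
            refl (fromℤ (z j)) h ⟩
        (h + h) - (y j - 0#)                      ≈⟨ +-congʳ ε≈h+h ⟨
        ε - (y j - 0#)                            ∎

    L-y : L y k ≈ fromℤ (slope σ ẑ k) * h
    L-y = begin
      fromℤ (σ (inject₁ k)) * pad 0# y 0# (suc k) - fromℤ (σ (suc k)) * pad 0# y 0# (inject₁ k)
        ≈⟨ +-cong (*-congˡ (pad-y (suc k))) (-‿cong (*-congˡ (pad-y (inject₁ k)))) ⟩
      fromℤ (σ (inject₁ k)) * (pad 0# (embed ℝ z) 0# (suc k) * h)
        - fromℤ (σ (suc k)) * (pad 0# (embed ℝ z) 0# (inject₁ k) * h)
        ≈⟨ solve 5 (λ s t a b h → s :* (a :* h) :- t :* (b :* h) := (s :* a :- t :* b) :* h) refl _ _ _ _ h ⟩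
      L (embed ℝ z) k * h
        ≈⟨ *-congʳ (L-embed z k) ⟩
      fromℤ (slope σ ẑ k) * h ∎
      where
      pad-y : ∀ i → pad 0# y 0# i ≈ pad 0# (embed ℝ z) 0# i * h
      pad-y = pad-lift (λ x y → x ≈ y * h) (sym (R.zeroˡ h)) (λ _ → refl) (sym (R.zeroˡ h))

  -- Facet `suc j` decreases along eⱼ, and facet `inject₁ j`, treated next, along -eⱼ. Together they
  -- reach every facet.
  0<κ-suc : ∀ j → + 0 ℤ.< κ (suc j)
  0<κ-suc j = slope<0⇒0<κ (δ j) (λ i → ℤ.≤-trans (ℤ.-≤+) (0≤δ j i)) (δ≤1 j) (suc j)
    (≡.subst (ℤ._< + 0) (≡.sym slope≡-σ) (ℤ.neg-mono-< (0<σ (suc (suc j)))))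
    where
    slope≡-σ : slope σ (pad (+ 0) (δ j) (+ 0)) (suc j) ≡ ℤ.- σ (suc (suc j))
    slope≡-σ rewrite slope-δ σ j (suc j) | δ-refl j | δ-sym (inject₁ j) (suc j) | δ-suc-inject₁ j =
      lemma (σ (suc (inject₁ j))) (σ (suc (suc j)))
      where
      lemma : ∀ a b → a ℤ.* + 0 ℤ.- b ℤ.* + 1 ≡ ℤ.- b
      lemma = solve-∀

  0<κ-inject₁ : ∀ j → + 0 ℤ.< κ (inject₁ j)
  0<κ-inject₁ j = slope<0⇒0<κ (ℤ.-_ ∘ δ j) (λ i → ℤ.neg-mono-≤ (δ≤1 j i))
    (λ i → ℤ.≤-trans (ℤ.neg-mono-≤ (0≤δ j i)) (ℤ.+≤+ ℕ.z≤n)) (inject₁ j)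
    (≡.subst (ℤ._< + 0) (≡.sym slope≡-σ) (ℤ.neg-mono-< (0<σ (inject₁ (inject₁ j)))))
    where
    slope≡-σ : slope σ (pad (+ 0) (ℤ.-_ ∘ δ j) (+ 0)) (inject₁ j) ≡ ℤ.- σ (inject₁ (inject₁ j))
    slope≡-σ rewrite slope-neg σ (δ j) (inject₁ j) | slope-δ σ j (inject₁ j)
                   | δ-refl (inject₁ j) | δ-suc-inject₁ j =
      lemma (σ (inject₁ (inject₁ j))) (σ (suc (inject₁ j)))
      where
      lemma : ∀ a b → ℤ.- (a ℤ.* + 1 ℤ.- b ℤ.* + 0) ≡ ℤ.- a
      lemma = solve-∀

  -- A positive integer facet value is at least 1. With all entries of σ at most N, moving each
  -- coordinate by less than ε = 1/(2N) lowers it by at most 2Nε = 1.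
  interior : ∀ z → (∀ k → + 0 ℤ.< κ k ℤ.+ slope σ (pad (+ 0) z (+ 0)) k) → Interior ℝ Q (embed ℝ z)
  interior z 0<κ+slope = ε , 0<ε , λ y y∈box → proj₂ Q≐ (near y y∈box)
    where
    ẑ = pad (+ 0) z (+ 0)
    N = proj₁ (upperBound σ 0<σ)
    σ≤N = proj₂ (proj₂ (upperBound σ 0<σ))

    0<N : + 0 ℤ.< N
    0<N = ℤ.<-≤-trans (0<σ zero) (σ≤N zero)

    ε-inverse = pos-inverse (0<fromℤ (ℤ.+-mono-< 0<N 0<N))
    ε = proj₁ ε-inverse

    0<ε : 0# < ε
    0<ε = inverse-pos (0<fromℤ (ℤ.+-mono-< 0<N 0<N)) (proj₂ ε-inverse)

    near : ∀ y → (∀ j → Within ε (y j) (embed ℝ z j)) → Polytope y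
    -- The facet value at `y` is a sum of five nonnegative terms: the integer value minus 1, one
    -- term for each of the two coordinate deviations, and (N - s)ε and (N - t)ε, which use up the
    -- rest of 2Nε = 1.
    near y y∈box k = ≤-respʳ-≈ total
      (+-mono-0≤ (0≤fromℤ (ℤ.i≤j⇒0≤j-i (ℤ.i<j⇒suc[i]≤j (0<κ+slope k))))
      (+-mono-0≤ (*-mono-0≤ 0≤s (proj₁ (deviation (suc k))))
      (+-mono-0≤ (*-mono-0≤ 0≤t (proj₂ (deviation (inject₁ k))))
      (+-mono-0≤ (*-mono-0≤ (0≤fromℤ (ℤ.i≤j⇒0≤j-i (σ≤N (inject₁ k)))) (<⇒≤ 0<ε))
                 (*-mono-0≤ (0≤fromℤ (ℤ.i≤j⇒0≤j-i (σ≤N (suc k)))) (<⇒≤ 0<ε))))))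
      where
      s t a b u v : Carrier
      s = fromℤ (σ (inject₁ k))
      t = fromℤ (σ (suc k))
      a = fromℤ (ẑ (suc k))
      b = fromℤ (ẑ (inject₁ k))
      u = pad 0# y 0# (suc k)
      v = pad 0# y 0# (inject₁ k)

      0≤s = <⇒≤ (0<fromℤ (0<σ (inject₁ k)))
      0≤t = <⇒≤ (0<fromℤ (0<σ (suc k)))

      total : fromℤ (κ k ℤ.+ slope σ ẑ k ℤ.- + 1) + (s * (u - a - (- ε)) + (t * (ε - (v - b)) +
                (fromℤ (N ℤ.- σ (inject₁ k)) * ε + fromℤ (N ℤ.- σ (suc k)) * ε)))
              ≈ fromℤ (κ k) + L y k
      total = begin
        fromℤ (κ k ℤ.+ slope σ ẑ k ℤ.- + 1) + (s * (u - a - (- ε)) + (t * (ε - (v - b)) +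
          (fromℤ (N ℤ.- σ (inject₁ k)) * ε + fromℤ (N ℤ.- σ (suc k)) * ε)))
          ≈⟨ +-cong slack (+-congˡ (+-congˡ (+-cong (*-congʳ (fromℤ-minus N _)) (*-congʳ (fromℤ-minus N _))))) ⟩
        (fromℤ (κ k) + (s * a - t * b)) - fromℤ (+ 1) + (s * (u - a - (- ε)) + (t * (ε - (v - b)) +
          ((fromℤ N - s) * ε + (fromℤ N - t) * ε)))
          ≈⟨ solve 9 (λ k s t a b u v n e →
               (k :+ (s :* a :- t :* b)) :- con (+ 1)
                 :+ (s :* (u :- a :- (:- e)) :+ (t :* (e :- (v :- b)) :+ ((n :- s) :* e :+ (n :- t) :* e)))
               := (n :+ n) :* e :- con (+ 1) :+ (k :+ (s :* u :- t :* v)))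
                 refl (fromℤ (κ k)) s t a b u v (fromℤ N) ε ⟩
        (fromℤ N + fromℤ N) * ε - fromℤ (+ 1) + (fromℤ (κ k) + (s * u - t * v))
          ≈⟨ +-congʳ (+-cong (trans (*-congʳ (sym (fromℤ-+ N N))) (proj₂ ε-inverse)) (-‿cong fromℤ-1)) ⟩
        1# - 1# + (fromℤ (κ k) + L y k)
          ≈⟨ trans (+-congʳ (-‿inverseʳ 1#)) (+-identityˡ _) ⟩
        fromℤ (κ k) + L y k ∎
        where
        slack : fromℤ (κ k ℤ.+ slope σ ẑ k ℤ.- + 1) ≈ (fromℤ (κ k) + (s * a - t * b)) - fromℤ (+ 1)
        slack = trans (fromℤ-minus (κ k ℤ.+ slope σ ẑ k) (+ 1)) (+-congʳ (trans (fromℤ-+ (κ k) (slope σ ẑ k))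
          (+-congˡ (trans (fromℤ-minus (σ (inject₁ k) ℤ.* ẑ (suc k)) (σ (suc k) ℤ.* ẑ (inject₁ k)))
            (+-cong (fromℤ-* (σ (inject₁ k)) (ẑ (suc k))) (-‿cong (fromℤ-* (σ (suc k)) (ẑ (inject₁ k)))))))))

      deviation : ∀ i → (0# ≤ pad 0# y 0# i - fromℤ (ẑ i) - (- ε)) × (0# ≤ ε - (pad 0# y 0# i - fromℤ (ẑ i)))
      deviation = pad-lift (λ x a → (0# ≤ x - fromℤ a - (- ε)) × (0# ≤ ε - (x - fromℤ a)))
        at-end (λ j → <⇒≤ (x<y⇒0<y-x (proj₁ (y∈box j))) , <⇒≤ (x<y⇒0<y-x (proj₂ (y∈box j)))) at-end
        where
        at-end : (0# ≤ 0# - 0# - (- ε)) × (0# ≤ ε - (0# - 0#))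
        at-end = ≤-respʳ-≈ (solve 1 (λ e → e := con (+ 0) :- con (+ 0) :- (:- e)) refl ε) (<⇒≤ 0<ε)
               , ≤-respʳ-≈ (solve 1 (λ e → e := e :- (con (+ 0) :- con (+ 0))) refl ε) (<⇒≤ 0<ε)

  unique : ∀ z → (∀ k → + 0 ℤ.< κ k ℤ.+ slope σ (pad (+ 0) z (+ 0)) k) → ∀ j → z j ≡ + 0
  unique z 0<κ+slope j = fromℤ-injective (proj₁ fano (interior z 0<κ+slope , z , λ _ → refl) j)

-- Lecture hall polytopes

0<x≤1⇒x≡1 : ∀ {x} → + 0 ℤ.< x → x ℤ.≤ + 1 → x ≡ + 1
0<x≤1⇒x≡1 0<x x≤1 = ℤ.≤-antisym x≤1 (ℤ.i<j⇒suc[i]≤j 0<x)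

0<a*x⇒0<x : ∀ a {x} → + 0 ℤ.< + a ℤ.* x → + 0 ℤ.< x
0<a*x⇒0<x a {x} 0<a*x = ℤ.*-cancelˡ-<-nonNeg (+ a) (≡.subst (ℤ._< + a ℤ.* x) (≡.sym (ℤ.*-zeroʳ (+ a))) 0<a*x)

a*x<a*y⇒x<y : ∀ a {x y} → + a ℤ.* x ℤ.< + a ℤ.* y → x ℤ.< y
a*x<a*y⇒x<y a = ℤ.*-cancelˡ-<-nonNeg (+ a)

factor : ∀ a q q′ → a ℤ.* q′ ℤ.- a ℤ.* q ≡ a ℤ.* (q′ ℤ.- q)
factor = solve-∀

-- Here κ = a (q′ - q) is a multiple of `a` that is positive and at most `a`.
step-equal : ∀ a q q′ → let κ = + a ℤ.* q′ ℤ.- + a ℤ.* q in + 0 ℤ.< κ → κ ℤ.≤ + a → κ ≡ + a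
step-equal zero    q q′ 0<κ κ≤a = contradiction 0<κ (ℤ.≤⇒≯ κ≤a)
step-equal (suc a) q q′ 0<κ κ≤a rewrite factor (+ suc a) q q′ =
  ≡.trans (≡.cong (+ suc a ℤ.*_) (0<x≤1⇒x≡1 (0<a*x⇒0<x (suc a) 0<κ)
    (ℤ.*-cancelˡ-≤-pos (q′ ℤ.- q) (+ 1) (+ suc a)
      (ℤ.≤-trans κ≤a (ℤ.≤-reflexive (≡.sym (ℤ.*-identityʳ (+ suc a))))))))
    (ℤ.*-identityʳ (+ suc a))

-- With r = a - q one has b r = κ + a. The bounds on κ together with a < b place this strictly
-- between 0 and 2b, so r = 1.
step-increasing : ∀ a b q → let κ = + a ℤ.* (+ b ℤ.- + 1) ℤ.- + b ℤ.* q in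
                  a ℕ.< b → + 0 ℤ.< κ → κ ℤ.≤ + a → + a ℤ.- q ≡ + 1
step-increasing a b q a<b 0<κ κ≤a = 0<x≤1⇒x≡1 (0<a*x⇒0<x b 0<b*r) (ℤ.≮⇒≥ 1≮r)
  where
  expand : ∀ a b q → a ℤ.* (b ℤ.- + 1) ℤ.- b ℤ.* q ℤ.+ a ≡ b ℤ.* (a ℤ.- q)
  expand = solve-∀

  0<b*r : + 0 ℤ.< + b ℤ.* (+ a ℤ.- q)
  0<b*r = ≡.subst (+ 0 ℤ.<_) (expand (+ a) (+ b) q) (ℤ.+-mono-<-≤ 0<κ (ℤ.+≤+ ℕ.z≤n))

  r<2 : + a ℤ.- q ℤ.< + 2
  r<2 = a*x<a*y⇒x<y b (≡.subst₂ ℤ._<_ (expand (+ a) (+ b) q) (double (+ b))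
    (ℤ.≤-<-trans (ℤ.+-monoˡ-≤ (+ a) κ≤a) (ℤ.+-mono-< (ℤ.+<+ a<b) (ℤ.+<+ a<b))))
    where
    double : ∀ b → b ℤ.+ b ≡ b ℤ.* + 2
    double = solve-∀

  1≮r : ¬ (+ 1 ℤ.< + a ℤ.- q)
  1≮r 1<r = ℤ.<⇒≱ r<2 (ℤ.i<j⇒suc[i]≤j 1<r)

-- The left side equals b (a - q) - a (b - q′), in which both brackets are 1.
step-difference : ∀ {a b q q′} → a ℕ.≤ b → + a ℤ.- q ≡ + 1 → + b ℤ.- q′ ≡ + 1 →
                  + a ℤ.* q′ ℤ.- + b ℤ.* q ≡ + (b ∸ a)
step-difference {a} {b} {q} {q′} a≤b a-q≡1 b-q′≡1 = begin
  + a ℤ.* q′ ℤ.- + b ℤ.* q                        ≡⟨ expand (+ a) (+ b) q q′ ⟩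
  + b ℤ.* (+ a ℤ.- q) ℤ.- + a ℤ.* (+ b ℤ.- q′)    ≡⟨ ≡.cong₂ (λ r r′ → + b ℤ.* r ℤ.- + a ℤ.* r′) a-q≡1 b-q′≡1 ⟩
  + b ℤ.* + 1 ℤ.- + a ℤ.* + 1                     ≡⟨ ≡.cong₂ ℤ._-_ (ℤ.*-identityʳ (+ b)) (ℤ.*-identityʳ (+ a)) ⟩
  + b ℤ.- + a                                     ≡⟨ ℤ.m-n≡m⊖n b a ⟩
  b ℤ.⊖ a                                         ≡⟨ ℤ.⊖-≥ a≤b ⟩
  + (b ∸ a)                                       ∎
  where
  open ≡.≡-Reasoning

  expand : ∀ a b q q′ → a ℤ.* q′ ℤ.- b ℤ.* q ≡ b ℤ.* (a ℤ.- q) ℤ.- a ℤ.* (b ℤ.- q′)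
  expand = solve-∀

-- The lecture hall polytope as a padded simplex

module _ {c ℓ₁ ℓ₂} (ℝ : RealNumbers c ℓ₁ ℓ₂) {n : ℕ} (s : Vector ℕ (suc n)) (s≢0 : ∀ j → NonZero (s j)) where

  private
    open RealNumbers ℝ 
    open OrderedField ℝ
    module R = CommutativeRing commutativeRing
    open SetoidReasoning R.setoid

  σ : Vector ℤ (3 ℕ.+ n)
  σ = pad (+ 1) (+_ ∘ s) (+ 1)

  σ-coordinate : ∀ j → σ (suc (inject₁ j)) ≡ + s j
  σ-coordinate = snoc-inject₁ (+_ ∘ s) (+ 1)

  σ-last : σ (fromℕ (2 ℕ.+ n)) ≡ + 1
  σ-last = snoc-fromℕ (+_ ∘ s) (+ 1)

  0<s : ∀ j → + 0 ℤ.< + s j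
  0<s j = ℤ.+<+ (ℕ.n≢0⇒n>0 (ℕ.≢-nonZero⁻¹ (s j) {{s≢0 j}}))

  0<σ : ∀ i → + 0 ℤ.< σ i
  0<σ = paddedCases _ (ℤ.+<+ (ℕ.s≤s ℕ.z≤n))
    (λ j → ≡.subst (+ 0 ℤ.<_) (≡.sym (σ-coordinate j)) (0<s j))
    (≡.subst (+ 0 ℤ.<_) (≡.sym σ-last) (ℤ.+<+ (ℕ.s≤s ℕ.z≤n)))

  -- Multiply Y - X by a b > 0. The ratios enter only through their products with `a` and `b`, so
  -- the end values 0 and 1, with denominator 1, are covered as well.
  ratio≤⇔ : ∀ {a b} → + 0 ℤ.< a → + 0 ℤ.< b → ∀ {x y X Y} → fromℤ a * X ≈ x → fromℤ b * Y ≈ y →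
            X ≤ Y ⇔ 0# ≤ fromℤ a * y - fromℤ b * x
  ratio≤⇔ {a} {b} 0<a 0<b {x} {y} {X} {Y} aX≈x bY≈y = mk⇔
    (λ X≤Y → ≤-respʳ-≈ cross (*-mono-0≤ (<⇒≤ 0<ab) (x≤y⇒0≤y-x X≤Y)))
    (λ 0≤cross → 0≤y-x⇒x≤y (*-cancelˡ-0≤ 0<ab (≤-respʳ-≈ (sym cross) 0≤cross)))
    where
    0<ab = *-pos (0<fromℤ 0<a) (0<fromℤ 0<b)

    cross : fromℤ a * fromℤ b * (Y - X) ≈ fromℤ a * y - fromℤ b * x
    cross = begin
      fromℤ a * fromℤ b * (Y - X)
        ≈⟨ solve 4 (λ a b X Y → a :* b :* (Y :- X) := a :* (b :* Y) :- b :* (a :* X))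
          refl (fromℤ a) (fromℤ b) X Y ⟩
      fromℤ a * (fromℤ b * Y) - fromℤ b * (fromℤ a * X) ≈⟨ +-cong (*-congˡ bY≈y) (-‿cong (*-congˡ aX≈x)) ⟩
      fromℤ a * y - fromℤ b * x                         ∎

  FacetInequality : Vector Carrier (suc n) → Fin (2 ℕ.+ n) → Set ℓ₂
  FacetInequality x k = 0# ≤ fromℤ (σ (inject₁ k)) * pad 0# x 1# (suc k)
                             - fromℤ (σ (suc k)) * pad 0# x 1# (inject₁ k)

  s*ratio≈x : ∀ j x → fromℤ (+ s j) * (_/_ x (s j) {{s≢0 j}}) ≈ x
  s*ratio≈x j x = begin
    fromℤ (+ s j) * (x * reciprocal (s j) {{s≢0 j}})
      ≈⟨ solve 3 (λ a x r → a :* (x :* r) := x :* (a :* r)) refl (fromℤ (+ s j)) x _ ⟩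
    x * (fromℤ (+ s j) * reciprocal (s j) {{s≢0 j}})   ≈⟨ *-congˡ (reciprocal-inverse (s j) {{s≢0 j}}) ⟩
    x * 1#                                             ≈⟨ *-identityʳ x ⟩
    x                                                  ∎

  module _ (x : Vector Carrier (suc n)) where

    ratio : Fin (suc n) → Carrier
    ratio j = _/_ (x j) (s j) {{s≢0 j}}

    facet-first : 0# ≤ ratio zero ⇔ FacetInequality x zero
    facet-first = ratio≤⇔ {+ 1} {+ s zero} (ℤ.+<+ (ℕ.s≤s ℕ.z≤n)) (0<s zero) (R.zeroʳ _)
      (s*ratio≈x zero (x zero))

    facet-inner : ∀ j → ratio (inject₁ j) ≤ ratio (suc j) ⇔ FacetInequality x (suc (inject₁ j))
    facet-inner j rewrite σ-coordinate (inject₁ j) | σ-coordinate (suc j)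
                        | snoc-inject₁ x 1# (inject₁ j) | snoc-inject₁ x 1# (suc j) =
      ratio≤⇔ {+ s (inject₁ j)} {+ s (suc j)} (0<s _) (0<s _) (s*ratio≈x (inject₁ j) _) (s*ratio≈x (suc j) _)

    facet-last : ratio (fromℕ n) ≤ 1# ⇔ FacetInequality x (suc (fromℕ n))
    facet-last rewrite σ-last | σ-coordinate (fromℕ n) | snoc-fromℕ x 1# | snoc-inject₁ x 1# (fromℕ n) =
      ratio≤⇔ {+ s (fromℕ n)} {+ 1} (0<s _) (ℤ.+<+ (ℕ.s≤s ℕ.z≤n)) (s*ratio≈x (fromℕ n) _)
        (trans (*-congʳ fromℤ-1) (*-identityˡ 1#))

  lectureHall≐facets : LectureHall ℝ s s≢0 ≐ (λ x → ∀ k → FacetInequality x k)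
  lectureHall≐facets =
    (λ {x} (0≤ratio , ratio≤ratio , ratio≤1) → paddedCases _
      (Equivalence.to (facet-first x) 0≤ratio)
      (λ j → Equivalence.to (facet-inner x j) (ratio≤ratio j))
      (Equivalence.to (facet-last x) ratio≤1)) ,
    (λ {x} x∈P →
      Equivalence.from (facet-first x) (x∈P zero) ,
      (λ j → Equivalence.from (facet-inner x j) (x∈P (suc (inject₁ j)))) ,
      Equivalence.from (facet-last x) (x∈P (suc (fromℕ n))))

  module Translated {ℓ} (Q : Pred (Vector Carrier (suc n)) ℓ) (t : Vector ℤ (suc n))
    (Q≐P+t : Q ≐ Translate ℝ t (LectureHall ℝ s s≢0)) where

    -- `Q` is the lecture hall polytope moved by `t`, so the origin of `Q` comes from the point -t.
    q : Vector ℤ (suc n)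
    q j = ℤ.- t j

    open Simplex ℝ σ 0<σ σ-last q public using (κ; L; Polytope)

    -- `y` padded by 0 and 1 is `x` padded by zeros plus `q` padded by 0 and 1, which splits each
    -- facet function into its value at q and its linear part.
    padded-shift : ∀ {x y} → (∀ j → y j ≈ x j + fromℤ (q j)) → ∀ k →
                   fromℤ (σ (inject₁ k)) * pad 0# y 1# (suc k) - fromℤ (σ (suc k)) * pad 0# y 1# (inject₁ k)
                   ≈ fromℤ (κ k) + L x k
    padded-shift {x} {y} y≈x+q k = begin
      fromℤ a * pad 0# y 1# (suc k) - fromℤ b * pad 0# y 1# (inject₁ k)
        ≈⟨ +-cong (*-congˡ (shift (suc k))) (-‿cong (*-congˡ (shift (inject₁ k)))) ⟩
      fromℤ a * (pad 0# x 0# (suc k) + fromℤ (q̂ (suc k)))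
        - fromℤ b * (pad 0# x 0# (inject₁ k) + fromℤ (q̂ (inject₁ k)))
        ≈⟨ solve 6 (λ a b u v p q → a :* (u :+ p) :- b :* (v :+ q) := (a :* p :- b :* q)
          :+ (a :* u :- b :* v)) refl (fromℤ a) (fromℤ b) _ _ _ _ ⟩
      (fromℤ a * fromℤ (q̂ (suc k)) - fromℤ b * fromℤ (q̂ (inject₁ k))) + L x k
        ≈⟨ +-congʳ (+-cong (fromℤ-* a (q̂ (suc k))) (-‿cong (fromℤ-* b (q̂ (inject₁ k))))) ⟨
      (fromℤ (a ℤ.* q̂ (suc k)) - fromℤ (b ℤ.* q̂ (inject₁ k))) + L x k
        ≈⟨ +-congʳ (fromℤ-minus (a ℤ.* q̂ (suc k)) (b ℤ.* q̂ (inject₁ k))) ⟨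
      fromℤ (κ k) + L x k ∎
      where
      a = σ (inject₁ k)
      b = σ (suc k)
      q̂ = pad (+ 0) q (+ 1)

      shift : ∀ i → pad 0# y 1# i ≈ pad 0# x 0# i + fromℤ (q̂ i)
      shift = pad-lift₃ (λ u v p → u ≈ v + fromℤ p) (sym (+-identityˡ 0#)) y≈x+q
        (sym (trans (+-congˡ fromℤ-1) (+-identityˡ 1#)))

    Q≐Polytope : Q ≐ Polytope
    Q≐Polytope = to , from
      where
      to : Q ⊆ Polytope
      to {x} x∈Q k = let y , y∈P , x≋y+t = proj₁ Q≐P+t x∈Q in
        ≤-respʳ-≈ (padded-shift (y≈x+q x y x≋y+t) k) (proj₁ lectureHall≐facets y∈P k)
        where
        y≈x+q : ∀ x y → (∀ j → x j ≈ y j + fromℤ (t j)) → ∀ j → y j ≈ x j + fromℤ (q j)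
        y≈x+q x y x≋y+t j = begin
          y j
            ≈⟨ solve 2 (λ y t → y := y :+ t :+ :- t) refl (y j) (fromℤ (t j)) ⟩
          y j + fromℤ (t j) + - fromℤ (t j)     ≈⟨ +-cong (x≋y+t j) (fromℤ-neg (t j)) ⟨
          x j + fromℤ (q j)                     ∎

      from : Polytope ⊆ Q
      from {x} x∈S = proj₂ Q≐P+t
        (y , proj₂ lectureHall≐facets (λ k → ≤-respʳ-≈ (sym (padded-shift {x} (λ j → refl) k)) (x∈S k)) , x≋y+t)
        where
        y : Vector Carrier (suc n)
        y j = x j + fromℤ (q j)

        x≋y+t : ∀ j → x j ≈ y j + fromℤ (t j)
        x≋y+t j = begin
          x j
            ≈⟨ solve 2 (λ x t → x := x :+ :- t :+ t) refl (x j) (fromℤ (t j)) ⟩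
          x j + - fromℤ (t j) + fromℤ (t j)     ≈⟨ +-congʳ (+-congˡ (fromℤ-neg (t j))) ⟨
          y j + fromℤ (t j)                     ∎

    module FanoLectureHall (fano : (Interior ℝ Q ∩ Lattice ℝ) ≐ Origin ℝ) where

      open FanoSimplex ℝ σ 0<σ σ-last q Q Q≐Polytope fano using (0<κ-suc; 0<κ-inject₁; unique)

      0<κ : ∀ k → + 0 ℤ.< κ k
      0<κ zero    = 0<κ-inject₁ zero
      0<κ (suc j) = 0<κ-suc j

      open UnitPerturbation σ 0<σ κ 0<κ unique
      open DualSimplex ℝ σ 0<σ σ-last q 0<κ Q Q≐Polytope public
        using (dual-latticePolytope; κ∣σ-of-latticePolytope)

      -- The outer entries of `σ` are 1, so positivity and the perturbation bound meet at both ends.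
      κ-first : κ zero ≡ + 1
      κ-first = 0<x≤1⇒x≡1 (0<κ zero) (κ-inject₁≤σ zero)

      κ-last : κ (suc (fromℕ n)) ≡ + 1
      κ-last = 0<x≤1⇒x≡1 (0<κ (suc (fromℕ n))) (ℤ.≤-trans (κ-suc≤σ (fromℕ n)) (ℤ.≤-reflexive σ-last))

      κ-inner : ∀ j → κ (suc (inject₁ j)) ≡ + s (inject₁ j) ℤ.* q (suc j) ℤ.- + s (suc j) ℤ.* q (inject₁ j)
      κ-inner j rewrite σ-coordinate (inject₁ j) | σ-coordinate (suc j)
                      | snoc-inject₁ q (+ 1) (inject₁ j) | snoc-inject₁ q (+ 1) (suc j) = ≡.refl

      0<κ-inner : ∀ j → + 0 ℤ.< + s (inject₁ j) ℤ.* q (suc j) ℤ.- + s (suc j) ℤ.* q (inject₁ j)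
      0<κ-inner j = ≡.subst (+ 0 ℤ.<_) (κ-inner j) (0<κ (suc (inject₁ j)))

      κ-inner≤s : ∀ j → + s (inject₁ j) ℤ.* q (suc j) ℤ.- + s (suc j) ℤ.* q (inject₁ j) ℤ.≤ + s (inject₁ j)
      κ-inner≤s j = ≡.subst₂ ℤ._≤_ (κ-inner j) (σ-coordinate (inject₁ j)) (κ-inject₁≤σ (suc j))

      module _ (i : Fin (suc n)) (constant : ∀ j → j Fin.≤ i → s j ≡ s zero)
        (increasing : ∀ (j : Fin n) → i Fin.≤ inject₁ j → s (inject₁ j) ℕ.< s (suc j)) where

        i≤suc : ∀ (j : Fin n) → i Fin.≤ inject₁ j → i Fin.≤ suc j
        i≤suc j i≤j = ℕ.≤-trans i≤j (ℕ.≤-trans (ℕ.≤-reflexive (Fin.toℕ-inject₁ j)) (ℕ.n≤1+n (Fin.toℕ j)))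

        -- The induction runs downwards because `step-increasing` needs the value of `q (suc j)`; it
        -- starts at the last coordinate, where s - q is the value of κ on the last facet.
        s-q≡1 : ∀ j → i Fin.≤ j → + s j ℤ.- q j ≡ + 1
        s-q≡1 = >-weakInduction _ (λ _ → last) step
          where
          last : + s (fromℕ n) ℤ.- q (fromℕ n) ≡ + 1
          last = ≡.trans (≡.sym κ-value) κ-last
            where
            lemma : ∀ a b → a ℤ.* + 1 ℤ.- + 1 ℤ.* b ≡ a ℤ.- b
            lemma = solve-∀

            κ-value : κ (suc (fromℕ n)) ≡ + s (fromℕ n) ℤ.- q (fromℕ n)
            κ-value rewrite σ-last | σ-coordinate (fromℕ n) | snoc-fromℕ q (+ 1)
                          | snoc-inject₁ q (+ 1) (fromℕ n) =
              lemma (+ s (fromℕ n)) (q (fromℕ n))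

          step : ∀ j → (i Fin.≤ suc j → + s (suc j) ℤ.- q (suc j) ≡ + 1) →
                 i Fin.≤ inject₁ j → + s (inject₁ j) ℤ.- q (inject₁ j) ≡ + 1
          step j IH i≤j = step-increasing (s (inject₁ j)) (s (suc j)) (q (inject₁ j)) (increasing j i≤j)
            (≡.subst (λ q′ → + 0 ℤ.< κ′ q′) q′≡s-1 (0<κ-inner j))
            (≡.subst (λ q′ → κ′ q′ ℤ.≤ + s (inject₁ j)) q′≡s-1 (κ-inner≤s j))
            where
            κ′ : ℤ → ℤ
            κ′ q′ = + s (inject₁ j) ℤ.* q′ ℤ.- + s (suc j) ℤ.* q (inject₁ j)

            q′≡s-1 : q (suc j) ≡ + s (suc j) ℤ.- + 1
            q′≡s-1 = ≡.trans (lemma (+ s (suc j)) (q (suc j)))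
              (≡.cong (λ r → + s (suc j) ℤ.- r) (IH (i≤suc j i≤j)))
              where
              lemma : ∀ a b → b ≡ a ℤ.- (a ℤ.- b)
              lemma = solve-∀

        κ-increasing : ∀ (j : Fin n) → i Fin.≤ inject₁ j → κ (suc (inject₁ j)) ≡ + (s (suc j) ∸ s (inject₁ j))
        κ-increasing j i≤j = ≡.trans (κ-inner j) (step-difference (ℕ.<⇒≤ (increasing j i≤j))
          (s-q≡1 (inject₁ j) i≤j) (s-q≡1 (suc j) (i≤suc j i≤j)))

        κ-constant : ∀ (j : Fin n) → suc j Fin.≤ i → s (suc j) ≡ s (inject₁ j) 
                     × κ (suc (inject₁ j)) ≡ + s (inject₁ j)
        κ-constant j j<i = s′≡s , ≡.trans (≡.trans (κ-inner j) (≡.cong κ′ s′≡s))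
            (step-equal (s (inject₁ j)) (q (inject₁ j)) (q (suc j))
              (≡.subst (λ b → + 0 ℤ.< κ′ b) s′≡s (0<κ-inner j))
              (≡.subst (λ b → κ′ b ℤ.≤ + s (inject₁ j)) s′≡s (κ-inner≤s j)))
          where
          κ′ : ℕ → ℤ
          κ′ b = + s (inject₁ j) ℤ.* q (suc j) ℤ.- + b ℤ.* q (inject₁ j)

          s′≡s : s (suc j) ≡ s (inject₁ j)
          s′≡s = ≡.trans (constant (suc j) j<i) (≡.sym (constant (inject₁ j)
            (ℕ.≤-trans (ℕ.≤-reflexive (Fin.toℕ-inject₁ j)) (ℕ.≤-trans (ℕ.n≤1+n (Fin.toℕ j)) j<i))))

        Divisibility : Set
        Divisibility = ∀ (j : Fin n) → i Fin.≤ inject₁ j →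
          (s (suc j) ∸ s (inject₁ j) ∣ s (inject₁ j)) × (s (suc j) ∸ s (inject₁ j) ∣ s (suc j))

        divisibility⇒reflexive : Divisibility → LatticePolytope ℝ (Dual ℝ Q)
        divisibility⇒reflexive divisible = dual-latticePolytope (proj₁ ∘ κ∣σ) (proj₂ ∘ κ∣σ)
          where
          κ∣σ : ∀ k → (∃ λ b → κ k ℤ.* b ≡ σ (inject₁ k)) × (∃ λ g → κ k ℤ.* g ≡ σ (suc k))
          -- On the two end facets κ is 1, which divides everything.
          κ∣σ = paddedCases _ (unit κ-first _ , unit κ-first _) inner (unit κ-last _ , unit κ-last _)
            where
            unit : ∀ {a} → a ≡ + 1 → ∀ b → ∃ λ c → a ℤ.* c ≡ b
            unit ≡.refl b = b , ℤ.*-identityˡ b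

            fromℕ-∣ : ∀ {a b k l} → k ≡ + a → l ≡ + b → a ∣ b → ∃ λ c → k ℤ.* c ≡ l
            fromℕ-∣ {a} ≡.refl ≡.refl (divides c ≡.refl) =
              + c , ≡.trans (ℤ.*-comm (+ a) (+ c)) (≡.sym (ℤ.pos-* c a))

            inner : ∀ j → (∃ λ b → κ (suc (inject₁ j)) ℤ.* b ≡ σ (suc (inject₁ (inject₁ j))))
                        × (∃ λ g → κ (suc (inject₁ j)) ℤ.* g ≡ σ (suc (suc (inject₁ j))))
            -- From `i` on, κ is the difference and the assumption applies; before `i`, κ equals
            -- both adjacent entries of `s`.
            inner j with ℕ.≤-<-connex (Fin.toℕ i) (Fin.toℕ (inject₁ j))
            ... | inj₁ i≤j = fromℕ-∣ (κ-increasing j i≤j) (σ-coordinate (inject₁ j)) (proj₁ (divisible j i≤j))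
                           , fromℕ-∣ (κ-increasing j i≤j) (σ-coordinate (suc j)) (proj₂ (divisible j i≤j))
            ... | inj₂ j<i = let s′≡s , κ≡s = κ-constant j (≡.subst (ℕ._< Fin.toℕ i) (Fin.toℕ-inject₁ j) j<i) in
                             fromℕ-∣ κ≡s (σ-coordinate (inject₁ j)) ∣-refl
                           , fromℕ-∣ κ≡s (≡.trans (σ-coordinate (suc j)) (≡.cong +_ s′≡s)) ∣-refl

        -- Integrality of a normal yields that k divides s (suc j); since s (suc j) = k + s (inject₁
        -- j), it divides the other entry too.
        reflexive⇒divisibility : LatticePolytope ℝ (Dual ℝ Q) → Divisibility
        reflexive⇒divisibility lattice j i≤j = ∣m+n∣m⇒∣n k∣k+s ∣-refl , k∣s′
          where
          k = s (suc j) ∸ s (inject₁ j)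

          k∣s′ : k ∣ s (suc j)
          k∣s′ = let z , κ*z≡σ = κ∣σ-of-latticePolytope lattice (inject₁ j) in
            divides ℤ.∣ z ∣ (≡.trans (≡.cong ℤ.∣_∣ (s′≡k*z z κ*z≡σ))
              (≡.trans (ℤ.abs-* (+ k) z) (ℕ.*-comm k ℤ.∣ z ∣)))
            where
            s′≡k*z : ∀ z → κ (suc (inject₁ j)) ℤ.* z ≡ σ (suc (suc (inject₁ j))) → + s (suc j) ≡ + k ℤ.* z
            s′≡k*z z κ*z≡σ = ≡.trans (≡.sym (≡.trans κ*z≡σ (σ-coordinate (suc j))))
                                     (≡.cong (ℤ._* z) (κ-increasing j i≤j))

          k∣k+s : k ∣ k ℕ.+ s (inject₁ j)
          k∣k+s = ≡.subst (k ∣_) (≡.sym (ℕ.m∸n+n≡m (ℕ.<⇒≤ (increasing j i≤j)))) k∣s′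

open import Data.Nat.Base using (_<_)

theorem2p6 : ∀ {c ℓ₁ ℓ₂} (ℝ : RealNumbers c ℓ₁ ℓ₂)
    {n : ℕ} (s : Vector ℕ (suc n)) (s≢0 : ∀ j → NonZero (s j))
    (i : Fin (suc n)) →
    (∀ j → j Fin.≤ i → s j ≡ s zero) →
    (∀ (j : Fin n) → i Fin.≤ inject₁ j → s (inject₁ j) < s (suc j)) →
    FanoUpToTranslation ℝ (LectureHall ℝ s s≢0) →
    ReflexiveUpToTranslation ℝ (LectureHall ℝ s s≢0) ⇔
    (∀ (j : Fin n) → i Fin.≤ inject₁ j →
    (s (suc j) ∸ s (inject₁ j) ∣ s (inject₁ j)) ×
    (s (suc j) ∸ s (inject₁ j) ∣ s (suc j)))
theorem2p6 ℝ s s≢0 i constant increasing (Q , Q-fano@(_ , _ , interior≐origin) , t , Q≐P+t) = mk⇔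
  -- The reflexive translate `Q′` has its own vector `t′`, and κ is computed from that vector. In
  -- the converse the given Fano translate `Q` is itself shown to be reflexive.
  (λ (Q′ , ((_ , _ , interior≐origin′) , dual-lattice) , t′ , Q′≐P+t′) →
    reflexive⇒divisibility ℝ s s≢0 Q′ t′ Q′≐P+t′ interior≐origin′ i constant increasing dual-lattice)
  (λ divisible →
    let dual-lattice = divisibility⇒reflexive ℝ s s≢0 Q t Q≐P+t interior≐origin i constant increasing divisible
    in Q , (Q-fano , dual-lattice) , t , Q≐P+t)
  where
  open Translated.FanoLectureHall
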